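{- Let $\mathbb{k}$ be a field of characteristic $0$ and let $n>1$ be an integer. Let $A=\sum_{i=1}^{n}(1,2,\ldots,i)\in\mathbb{k}S_n$ (the top-to-random shuffle), where $(1,2,\ldots,i)$ denotes the cycle $1\mapsto 2\mapsto\cdots\mapsto i\mapsto 1$ (for $i=1$ this is the identity). Let $w_0\in S_n$ be the permutation $w_0(j)=n+1-j$. Then the elements $w_0A$ and $Aw_0$ of $\mathbb{k}S_n$ both have minimal polynomial \[ \prod_{k\in L(n)}(x-k),\qquad L(n):=\{ -n+2\}\cup\{k\in\mathbb{Z}: -n+4\le k\le n-3\}\cup\{0\}\cup\{n\} \] (the product over the distinct elements of the set $L(n)$).
   Context: $S_n$ is the symmetric group of $\{1,\ldots,n\}$ with product $(\sigma\tau)(i)=\sigma(\tau(i))$, and $\mathbb{k}S_n$ its group algebra. The minimal polynomial of an element $a$ of a finite-dimensional $\mathbb{k}$-algebra is the monic polynomial of least degree annihilating $a$. -}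

module Defs where

open import Level using (Level; _⊔_) renaming (suc to lsuc)
open import Algebra.Bundles using (CommutativeRing)
open import Data.Nat as ℕ using (ℕ; zero; suc)
import Data.Nat.Properties as NatP
open import Data.Integer as ℤ using (ℤ; +_; -[1+_])
open import Data.Fin as Fin using (Fin; toℕ; opposite)
open import Data.Fin.Properties as FinP using ()
open import Data.Vec as Vec using (Vec; []; _∷_; lookup; tabulate; toList)
open import Data.Vec.Properties using (≡-dec)
open import Data.List as List using (List; []; _∷_; _++_; _∷ʳ_; length; filter; concatMap; foldr; map)
open import Data.List.Membership.Propositional using (_∈_)
open import Data.List.Relation.Unary.Unique.Propositional using (Unique)
import Data.List.Relation.Unary.Unique.DecPropositional as UDec
open import Data.Product using (Σ; ∃; _×_; _,_)
open import Data.Sum using (_⊎_)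
open import Relation.Nullary.Decidable using (_⊎-dec_; _×-dec_)
open import Relation.Nullary using (¬_; Dec; yes; no; does)
open import Relation.Binary.PropositionalEquality using (_≡_)
open import Data.Bool using (if_then_else_)

record Field (c ℓ : Level) : Set (lsuc (c ⊔ ℓ)) where
  field
    commutativeRing : CommutativeRing c ℓ
  open CommutativeRing commutativeRing public
  field
    1≉0     : ¬ (1# ≈ 0#)
    inverse : ∀ x → ¬ (x ≈ 0#) → Σ Carrier λ y → x * y ≈ 1#

module FieldOps {c ℓ} (F : Field c ℓ) where
  open Field F

  natK : ℕ → Carrier
  natK zero    = 0#
  natK (suc m) = 1# + natK m

  intK : ℤ → Carrier
  intK (+ m)      = natK m
  intK -[1+ m ]   = - natK (suc m)

  CharZero : Set ℓ
  CharZero = ∀ m → ¬ (natK (suc m) ≈ 0#)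

  -- Polynomials over the field: coefficient lists, lowest degree first.
  Poly : Set c
  Poly = List Carrier

  addP : Poly → Poly → Poly
  addP []       q        = q
  addP (a ∷ p)  []       = a ∷ p
  addP (a ∷ p)  (b ∷ q)  = (a + b) ∷ addP p q

  mulP : Poly → Poly → Poly
  mulP []      q = []
  mulP (a ∷ p) q = addP (map (a *_) q) (0# ∷ mulP p q)

  linear : Carrier → Poly
  linear k = (- k) ∷ 1# ∷ []

  prodP : List Carrier → Poly
  prodP = foldr (λ k p → mulP (linear k) p) (1# ∷ [])

  MonicOfDegree : ℕ → Poly → Set (c ⊔ ℓ)
  MonicOfDegree d p = Σ (List Carrier) λ cs → Σ Carrier λ lc →
                        (p ≡ cs ∷ʳ lc) × (length cs ≡ d) × (lc ≈ 1#)

-- The symmetric group S_n and the group algebra 𝕜S_n.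
-- A permutation σ of {1,…,n} (0-indexed as Fin n) is represented by the
-- vector (σ(0),…,σ(n-1)) with pairwise distinct entries.

allVecs : (n m : ℕ) → List (Vec (Fin n) m)
allVecs n zero    = [] ∷ []
allVecs n (suc m) = concatMap (λ i → map (i ∷_) (allVecs n m)) (List.allFin n)

IsPerm : ∀ {n} → Vec (Fin n) n → Set
IsPerm σ = Unique (toList σ)

isPerm? : ∀ {n} (σ : Vec (Fin n) n) → Dec (IsPerm σ)
isPerm? σ = UDec.unique? FinP._≟_ (toList σ)

perms : (n : ℕ) → List (Vec (Fin n) n)
perms n = filter isPerm? (allVecs n n)

_∘ₚ_ : ∀ {n} → Vec (Fin n) n → Vec (Fin n) n → Vec (Fin n) n
σ ∘ₚ τ = tabulate (λ i → lookup σ (lookup τ i))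

-- the cycle (1,2,…,i) for 1 ≤ i ≤ n, given by j : Fin n with i = j + 1;
-- 0-indexed: k ↦ k+1 for k < j, j ↦ 0, k ↦ k for k > j.
cycle : ∀ {n} → Fin n → Vec (Fin n) n
cycle {suc m} j = tabulate f
  where
  f : Fin (suc m) → Fin (suc m)
  f k with toℕ k ℕ.<? toℕ j
  ... | yes k<j = Fin.fromℕ< (NatP.≤-<-trans k<j (FinP.toℕ<n j))
  ... | no _ with k FinP.≟ j
  ...   | yes _ = Fin.zero
  ...   | no _  = k

w₀ : ∀ {n} → Vec (Fin n) n
w₀ = tabulate opposite

-- The group algebra 𝕜S_n: an element is a function assigning a
-- coefficient to each permutation (values off S_n are irrelevant).

module GroupAlgebra {c ℓ} (F : Field c ℓ) (n : ℕ) where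
  open Field F
  open FieldOps F public

  Perm : Set
  Perm = Vec (Fin n) n

  KS : Set c
  KS = Perm → Carrier

  _≈ₐ_ : KS → KS → Set ℓ
  a ≈ₐ b = ∀ σ → σ ∈ perms n → a σ ≈ b σ

  sumOver : List Perm → (Perm → Carrier) → Carrier
  sumOver xs f = foldr (λ σ r → f σ + r) 0# xs

  δ : Perm → KS
  δ π σ = if does (≡-dec FinP._≟_ π σ) then 1# else 0#

  0ₐ : KS
  0ₐ _ = 0#

  _+ₐ_ : KS → KS → KS
  (a +ₐ b) σ = a σ + b σ

  scalar : Carrier → KS
  scalar k σ = k * δ (tabulate (λ i → i)) σ

  _*ₐ_ : KS → KS → KS
  (a *ₐ b) σ = sumOver (perms n) λ ρ → sumOver (perms n) λ τ →
                 if does (≡-dec FinP._≟_ (ρ ∘ₚ τ) σ) then a ρ * b τ else 0#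

  evalP : Poly → KS → KS
  evalP []      a = 0ₐ
  evalP (k ∷ p) a = scalar k +ₐ (a *ₐ evalP p a)

  IsMinimalPolynomial : KS → Poly → Set (c ⊔ ℓ)
  IsMinimalPolynomial a p = Σ ℕ λ d → MonicOfDegree d p × (evalP p a ≈ₐ 0ₐ) ×
                              (∀ e q → MonicOfDegree e q → evalP q a ≈ₐ 0ₐ → d ℕ.≤ e)

  A : KS
  A σ = sumOver (List.map cycle (List.allFin n)) λ π → δ π σ

  W₀ : KS
  W₀ = δ w₀

InL : ℕ → ℤ → Set
InL n k = (k ≡ ℤ.- (+ n) ℤ.+ + 2)
        ⊎ ((ℤ.- (+ n) ℤ.+ + 4 ℤ.≤ k) × (k ℤ.≤ + n ℤ.- + 3))
        ⊎ (k ≡ + 0) ⊎ (k ≡ + n)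

inL? : ∀ n k → Dec (InL n k)
inL? n k = (k ℤ.≟ ℤ.- (+ n) ℤ.+ + 2)
        ⊎-dec (((ℤ.- (+ n) ℤ.+ + 4) ℤ.≤? k) ×-dec (k ℤ.≤? + n ℤ.- + 3))
        ⊎-dec (k ℤ.≟ + 0) ⊎-dec (k ℤ.≟ + n)

intRange : ℕ → List ℤ
intRange n = List.map (λ i → ℤ.- (+ n) ℤ.+ + i) (List.upTo (suc (2 ℕ.* n)))

-- the distinct elements of L(n) (all lie in [-n, n]), each listed once
Lset : ℕ → List ℤ
Lset n = filter (inL? n) (intRange n)

minPolyL : ∀ {c ℓ} (F : Field c ℓ) → ℕ → List (Field.Carrier F)
minPolyL F n = FieldOps.prodP F (List.map (FieldOps.intK F) (Lset n))

{-# OPTIONS --safe #-}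
module Submission where

open import Defs
open import Algebra.Bundles using (AbelianGroup)
open import Data.Bool as Bool using (Bool; true; false; if_then_else_)
open import Data.Fin as Fin using (Fin; zero; suc; toℕ; opposite)
import Data.Fin.Properties as FinP
open import Data.Integer as ℤ using (ℤ; +_; -[1+_])
import Data.Integer.Properties as ℤP
open import Data.List as List using (List; []; _∷_; _∷ʳ_; length; reverse; map; foldr; replicate; concatMap; cartesianProductWith)
import Data.List.Properties as ListP
open import Data.List.Membership.Propositional using (_∈_)
open import Data.List.Membership.Propositional.Properties
open import Data.List.Relation.Unary.All as All using (All; []; _∷_)
import Data.List.Relation.Unary.All.Properties as AllP
open import Data.List.Relation.Unary.AllPairs as AllPairs using (AllPairs; []; _∷_)
import Data.List.Relation.Unary.AllPairs.Properties as AllPairsP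
open import Data.List.Relation.Unary.Any using (here; there)
open import Data.List.Relation.Unary.Unique.Propositional using (Unique)
import Data.List.Relation.Unary.Unique.Propositional.Properties as UniqueP
open import Data.Nat as ℕ using (ℕ; zero; suc; _<_)
import Data.Nat.Properties as ℕP
open import Data.Product using (Σ; ∃; _×_; _,_; proj₁; proj₂)
open import Data.Sum using (inj₁; inj₂)
open import Data.Vec as Vec using (Vec; []; _∷_; lookup; tabulate; toList; insertAt)
import Data.Vec.Properties as VecP
open import Function using (id; _∘_)
open import Level using (Level; _⊔_)
open import Relation.Binary.Definitions using (DecidableEquality)
open import Relation.Binary.PropositionalEquality as ≡ using (_≡_; _≢_)
open import Relation.Nullary using (¬_; yes; no; does; contradiction)

-- Let 𝕜Sₙ act by place permutations on functions on words of length n.  Then A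
-- acts as v ↦ (x ∷ u ↦ (∂ x v) u), where ∂ x sums v over all insertions of x
-- into u, and w₀ acts by reversal.  The ∂ x are commuting derivations of the
-- free algebra, they commute with reversal, and ∂ x A = A ∂ x + ∂ x.  Hence if T
-- is the action of w₀A or Aw₀, if v is killed by all products of m + 1
-- derivations and D is a product of m of them, then D T v = m · (D v) reversed.
-- So (T - m)(T + m) lowers m by one, and one factor is enough if D v is even or
-- odd under reversal.  This happens for m = 0 (where T v = 0) and when D v has
-- degree n - m at most 3: it is even in degrees 0 and 3, zero in degree 1 and
-- odd in degree 2.  The surviving factors are those for the elements of L(n).
--
-- Conversely, let Q be a function of degree d = n - m killed by all ∂ x and with
-- sign ε under reversal.  Then v = aᵐQ and D = (∂ a)ᵐ show that ε m is a root of
-- every polynomial annihilating T.  Suitable Q are 1, [a,b], [a,b]² and their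
-- iterated commutators with a.

-- Permutations as vectors and their action on words by places.

private variable
  ℓ₀ : Level
  X : Set ℓ₀
  n : ℕ

act : Vec X n → Vec (Fin n) n → Vec X n
act u σ = tabulate (λ i → lookup u (lookup σ i))

act-∘ₚ : ∀ (u : Vec X n) ρ τ → act u (ρ ∘ₚ τ) ≡ act (act u ρ) τ
act-∘ₚ u ρ τ = VecP.tabulate-cong λ i →
  ≡.trans (≡.cong (lookup u) (VecP.lookup∘tabulate _ i))
        (≡.sym (VecP.lookup∘tabulate _ (lookup τ i)))

act-id : ∀ (u : Vec X n) → act u (tabulate id) ≡ u
act-id u = ≡.trans (VecP.tabulate-cong λ i → ≡.cong (lookup u) (VecP.lookup∘tabulate id i))
                 (VecP.tabulate∘lookup u)

-- The word `tabulate id` has distinct letters, so a permutation can be read off from its effect on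
-- this one word. This is what makes the place action faithful.
id-act : ∀ (σ : Vec (Fin n) n) → act (tabulate id) σ ≡ σ
id-act σ = ≡.trans (VecP.tabulate-cong λ i → VecP.lookup∘tabulate id (lookup σ i))
                 (VecP.tabulate∘lookup σ)

lookup∈toList : ∀ (u : Vec X n) i → lookup u i ∈ toList u
lookup∈toList (x ∷ u) zero    = here ≡.refl
lookup∈toList (x ∷ u) (suc i) = there (lookup∈toList u i)

unique⇒lookup-injective : ∀ (u : Vec X n) → Unique (toList u) →
                          ∀ {i j} → lookup u i ≡ lookup u j → i ≡ j
unique⇒lookup-injective (x ∷ u) _ {zero} {zero} _ = ≡.refl
unique⇒lookup-injective (x ∷ u) (x∉ ∷ _) {zero} {suc j} eq =
  contradiction eq (All.lookup x∉ (lookup∈toList u j))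
unique⇒lookup-injective (x ∷ u) (x∉ ∷ _) {suc i} {zero} eq =
  contradiction (≡.sym eq) (All.lookup x∉ (lookup∈toList u i))
unique⇒lookup-injective (x ∷ u) (_ ∷ uniq) {suc i} {suc j} eq =
  ≡.cong suc (unique⇒lookup-injective u uniq eq)

toList-tabulate : ∀ (f : Fin n → X) → toList (tabulate f) ≡ List.tabulate f
toList-tabulate {n = zero}  f = ≡.refl
toList-tabulate {n = suc n} f = ≡.cong (f zero ∷_) (toList-tabulate (f ∘ suc))

tabulate-isPerm : ∀ {f : Fin n → Fin n} → (∀ {i j} → f i ≡ f j → i ≡ j) → IsPerm (tabulate f)
tabulate-isPerm {f = f} inj = ≡.subst Unique (≡.sym (toList-tabulate f)) (UniqueP.tabulate⁺ inj)

∘ₚ-isPerm : ∀ (σ τ : Vec (Fin n) n) → IsPerm σ → IsPerm τ → IsPerm (σ ∘ₚ τ)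
∘ₚ-isPerm σ τ pσ pτ =
  tabulate-isPerm (unique⇒lookup-injective τ pτ ∘ unique⇒lookup-injective σ pσ)

-- Exhibits `allVecs` as an iterated Cartesian product, so that membership and distinctness follow
-- from those of the factors.
concatMap-map : ∀ {A B C : Set} (f : A → B → C) xs ys →
                concatMap (λ x → map (f x) ys) xs ≡ cartesianProductWith f xs ys
concatMap-map f []       ys = ≡.refl
concatMap-map f (x ∷ xs) ys = ≡.cong (map (f x) ys List.++_) (concatMap-map f xs ys)

allVecs-unique : ∀ n m → Unique (allVecs n m)
allVecs-unique n zero    = [] ∷ []
allVecs-unique n (suc m) =
  ≡.subst Unique (≡.sym (concatMap-map _∷_ (List.allFin n) (allVecs n m)))
    (UniqueP.cartesianProductWith⁺ _∷_ VecP.∷-injective (UniqueP.allFin⁺ n) (allVecs-unique n m))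

∈-allVecs : ∀ {n m} (u : Vec (Fin n) m) → u ∈ allVecs n m
∈-allVecs []      = here ≡.refl
∈-allVecs {n} {suc m} (i ∷ u) =
  ≡.subst (i ∷ u ∈_) (≡.sym (concatMap-map _∷_ (List.allFin n) (allVecs n m)))
    (∈-cartesianProductWith⁺ _∷_ (∈-allFin i) (∈-allVecs u))

perms-unique : ∀ n → Unique (perms n)
perms-unique n = UniqueP.filter⁺ isPerm? (allVecs-unique n n)

isPerm⇒∈ : ∀ {σ : Vec (Fin n) n} → IsPerm σ → σ ∈ perms n
isPerm⇒∈ {σ = σ} = ∈-filter⁺ isPerm? (∈-allVecs σ)

∈⇒isPerm : ∀ {σ : Vec (Fin n) n} → σ ∈ perms n → IsPerm σ
∈⇒isPerm {n} σ∈ = proj₂ (∈-filter⁻ isPerm? {xs = allVecs n n} σ∈)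

∘ₚ-∈ : ∀ {σ τ : Vec (Fin n) n} → σ ∈ perms n → τ ∈ perms n → (σ ∘ₚ τ) ∈ perms n
∘ₚ-∈ {σ = σ} {τ} σ∈ τ∈ = isPerm⇒∈ (∘ₚ-isPerm σ τ (∈⇒isPerm σ∈) (∈⇒isPerm τ∈))

id∈perms : tabulate id ∈ perms n
id∈perms = isPerm⇒∈ (tabulate-isPerm id)

w₀∈perms : w₀ ∈ perms n
w₀∈perms = isPerm⇒∈ (tabulate-isPerm λ {i} {j} eq →
  ≡.trans (≡.sym (FinP.opposite-involutive i)) (≡.trans (≡.cong opposite eq) (FinP.opposite-involutive j)))

-- The permutation `w₀` as reversal of words.

tabulate-∷ʳ : ∀ (f : Fin (suc n) → X) →
              List.tabulate f ≡ List.tabulate (f ∘ Fin.inject₁) ∷ʳ f (Fin.fromℕ n)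
tabulate-∷ʳ {n = zero}  f = ≡.refl
tabulate-∷ʳ {n = suc n} f = ≡.cong (f zero ∷_) (tabulate-∷ʳ (f ∘ suc))

-- Since `opposite` sends `zero` to the last index and `suc i` to `inject₁ (opposite i)`, the
-- induction has to split off the last entry of `f` instead of the first.
tabulate-opposite : ∀ (f : Fin n → X) → List.tabulate (f ∘ opposite) ≡ reverse (List.tabulate f)
tabulate-opposite {n = zero}  f = ≡.refl
tabulate-opposite {n = suc n} f = begin
  f (Fin.fromℕ n) ∷ List.tabulate (f ∘ Fin.inject₁ ∘ opposite)
    ≡⟨ ≡.cong (f (Fin.fromℕ n) ∷_) (tabulate-opposite (f ∘ Fin.inject₁)) ⟩
  f (Fin.fromℕ n) ∷ reverse (List.tabulate (f ∘ Fin.inject₁))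
    ≡⟨ ListP.reverse-++ (List.tabulate (f ∘ Fin.inject₁)) (f (Fin.fromℕ n) ∷ []) ⟨
  reverse (List.tabulate (f ∘ Fin.inject₁) ∷ʳ f (Fin.fromℕ n))
    ≡⟨ ≡.cong reverse (tabulate-∷ʳ f) ⟨
  reverse (List.tabulate f) ∎
  where open ≡.≡-Reasoning

toList-act-w₀ : ∀ (u : Vec X n) → toList (act u w₀) ≡ reverse (toList u)
toList-act-w₀ u = begin
  toList (act u w₀)                       ≡⟨ ≡.cong toList (VecP.tabulate-cong λ i →
                                               ≡.cong (lookup u) (VecP.lookup∘tabulate opposite i)) ⟩
  toList (tabulate (lookup u ∘ opposite)) ≡⟨ toList-tabulate (lookup u ∘ opposite) ⟩
  List.tabulate (lookup u ∘ opposite)     ≡⟨ tabulate-opposite (lookup u) ⟩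
  reverse (List.tabulate (lookup u))      ≡⟨ ≡.cong reverse (toList-tabulate (lookup u)) ⟨
  reverse (toList (tabulate (lookup u)))  ≡⟨ ≡.cong (reverse ∘ toList) (VecP.tabulate∘lookup u) ⟩
  reverse (toList u)                      ∎
  where open ≡.≡-Reasoning

-- Cycles as insertions of the first letter.

lookup-insertAt-< : ∀ (u : Vec X n) i x (k : Fin (suc n)) (l : Fin (suc n)) →
                    toℕ k ℕ.< toℕ i → toℕ l ≡ suc (toℕ k) →
                    lookup (insertAt u i x) k ≡ lookup (x ∷ u) l
lookup-insertAt-< (y ∷ u) (suc i) x zero    (suc zero)    _  _  = ≡.refl
lookup-insertAt-< (y ∷ u) (suc i) x (suc k) (suc (suc l)) (ℕ.s≤s k<i) eq =
  lookup-insertAt-< u i x k (suc l) k<i (ℕP.suc-injective eq)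

lookup-insertAt-> : ∀ (u : Vec X n) i x (k : Fin (suc n)) → toℕ i ℕ.< toℕ k →
                    lookup (insertAt u i x) k ≡ lookup (x ∷ u) k
lookup-insertAt-> u       zero    x (suc k)       _ = ≡.refl
lookup-insertAt-> (y ∷ u) (suc i) x (suc (suc k)) (ℕ.s≤s i<k) = lookup-insertAt-> u i x (suc k) i<k

-- The graph of `cycle i`, split into the same three cases as the entries of `insertAt u i x`:
-- before, at and after the inserted letter.
data CycleAt (i k : Fin (suc n)) : Fin (suc n) → Set where
  below : ∀ {l} → toℕ k ℕ.< toℕ i → toℕ l ≡ suc (toℕ k) → CycleAt i k l
  equal : k ≡ i → CycleAt i k zero
  above : toℕ i ℕ.< toℕ k → CycleAt i k k

-- The function tabulated by cycle is local to Defs and has no name here: the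
-- placeholder in the type of cycleAt-suc is solved to it by the use in cycleAt.
mutual
  cycleAt : ∀ (i k : Fin (suc n)) → CycleAt i k (lookup (cycle i) k)
  cycleAt i zero with 0 ℕ.<? toℕ i
  ... | yes 0<i = below 0<i (FinP.toℕ-fromℕ< (ℕP.≤-<-trans 0<i (FinP.toℕ<n i)))
  ... | no 0≮i with zero FinP.≟ i
  ...   | yes 0≡i = equal 0≡i
  ...   | no 0≢i  = contradiction (ℕP.n≢0⇒n>0 (0≢i ∘ ≡.sym ∘ FinP.toℕ-injective)) 0≮i
  cycleAt i (suc k) =
    ≡.subst (CycleAt i (suc k)) (≡.sym (VecP.lookup∘tabulate _ k)) (cycleAt-suc i k)

  cycleAt-suc : ∀ (i : Fin (suc n)) (k : Fin n) → CycleAt i (suc k) _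
  cycleAt-suc i k with suc (toℕ k) ℕ.<? toℕ i
  ... | yes k<i = below k<i (FinP.toℕ-fromℕ< (ℕP.≤-<-trans k<i (FinP.toℕ<n i)))
  ... | no k≮i with suc k FinP.≟ i
  ...   | yes k≡i = equal k≡i
  ...   | no k≢i  = above (ℕP.≤∧≢⇒< (ℕP.≮⇒≥ k≮i) (k≢i ∘ ≡.sym ∘ FinP.toℕ-injective))

lookup-insertAt : ∀ (u : Vec X n) x {i k l} → CycleAt i k l →
                  lookup (insertAt u i x) k ≡ lookup (x ∷ u) l
lookup-insertAt u x {i} {k} {l} (below k<i l≡1+k) = lookup-insertAt-< u i x k l k<i l≡1+k
lookup-insertAt u x {i}         (equal ≡.refl)      = VecP.insertAt-lookup u i x
lookup-insertAt u x {i} {k}     (above i<k)       = lookup-insertAt-> u i x k i<k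

-- Places below `i` read the next letter of `x ∷ u`, place `i` reads the first one, and places above
-- `i` are fixed. So the cycle moves the first letter to place `i`, which is one move of the
-- shuffle.
act-cycle : ∀ (u : Vec X n) i x → act (x ∷ u) (cycle i) ≡ insertAt u i x
act-cycle u i x = ≡.trans (VecP.tabulate-cong λ k → ≡.sym (lookup-insertAt u x (cycleAt i k)))
                        (VecP.tabulate∘lookup (insertAt u i x))

insertAt-all : ∀ {P : X → Set} (u : Vec X n) i {x} → P x → All P (toList u) →
               All P (toList (insertAt u i x))
insertAt-all u       zero    px pu        = px ∷ pu
insertAt-all (y ∷ u) (suc i) px (py ∷ pu) = py ∷ insertAt-all u i px pu

insertAt-unique : ∀ {X : Set} (u : Vec X n) i {x} → Unique (toList (x ∷ u)) →
                  Unique (toList (insertAt u i x))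
insertAt-unique u       zero    uniq                          = uniq
insertAt-unique (y ∷ u) (suc i) ((x≢y ∷ x∉u) ∷ (y∉u ∷ uniq)) =
  insertAt-all u i (x≢y ∘ ≡.sym) y∉u ∷ insertAt-unique u i (x∉u ∷ uniq)

-- By `act-cycle`, the entries of `cycle i` are those of the identity with 0 moved to place `i`, and
-- insertion keeps entries distinct.
cycle∈perms : ∀ (i : Fin n) → cycle i ∈ perms n
cycle∈perms {suc n} i = isPerm⇒∈ (≡.subst (Unique ∘ toList)
  (≡.trans (≡.sym (act-cycle (tabulate suc) i zero)) (id-act (cycle i)))
  (insertAt-unique (tabulate suc) i (tabulate-isPerm id)))

-- Derivations on functions on words, and the shuffle operator.

module Words {c ℓ} (F : Field c ℓ) {a} (X : Set a) where
  open Field F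
  open FieldOps F
  open import Relation.Binary.Reasoning.Setoid setoid
  open import Algebra.Solver.Ring.NaturalCoefficients.Default commutativeSemiring

  Fun : Set _
  Fun = List X → Carrier

  private variable
    v w : Fun

  infix 4 _≋_
  _≋_ : Fun → Fun → Set _
  v ≋ w = ∀ u → v u ≈ w u

  infixl 6 _⊕_
  infixr 7 _⊙_

  _⊕_ : Fun → Fun → Fun
  (v ⊕ w) u = v u + w u

  _⊙_ : Carrier → Fun → Fun
  (k ⊙ v) u = k * v u

  record IsLinear (T : Fun → Fun) : Set (a ⊔ c ⊔ ℓ) where
    field
      T-cong : v ≋ w → T v ≋ T w
      T-⊕    : ∀ v w → T (v ⊕ w) ≋ T v ⊕ T w
      T-⊙    : ∀ k v → T (k ⊙ v) ≋ k ⊙ T v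

    T-0 : T (λ _ → 0#) ≋ (λ _ → 0#)
    T-0 u = trans (T-cong (λ _ → sym (zeroˡ 0#)) u) (trans (T-⊙ 0# (λ _ → 0#) u) (zeroˡ _))

  -- Coefficientwise transpose of deletion: if v is the coefficient function
  -- of a noncommutative polynomial, then ∂ x v is that of its image under the
  -- derivation sending the letter x to 1 and the other letters to 0.
  ∂ : X → Fun → Fun
  ∂ x v []      = v (x ∷ [])
  ∂ x v (y ∷ u) = v (x ∷ y ∷ u) + ∂ x (v ∘ (y ∷_)) u

  ∂-linear : ∀ x → IsLinear (∂ x)
  ∂-linear x = record { T-cong = ∂-cong ; T-⊕ = ∂-⊕ ; T-⊙ = ∂-⊙ }
    where
    ∂-cong : v ≋ w → ∂ x v ≋ ∂ x w
    ∂-cong eq []      = eq (x ∷ [])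
    ∂-cong eq (y ∷ u) = +-cong (eq (x ∷ y ∷ u)) (∂-cong (eq ∘ (y ∷_)) u)

    ∂-⊕ : ∀ v w → ∂ x (v ⊕ w) ≋ ∂ x v ⊕ ∂ x w
    ∂-⊕ v w []      = refl
    ∂-⊕ v w (y ∷ u) = trans (+-congˡ (∂-⊕ (v ∘ (y ∷_)) (w ∘ (y ∷_)) u))
      (solve 4 (λ p q r s → (p :+ q) :+ (r :+ s) := (p :+ r) :+ (q :+ s)) refl _ _ _ _)

    ∂-⊙ : ∀ k v → ∂ x (k ⊙ v) ≋ k ⊙ ∂ x v
    ∂-⊙ k v []      = refl
    ∂-⊙ k v (y ∷ u) = trans (+-congˡ (∂-⊙ k (v ∘ (y ∷_)) u)) (sym (distribˡ k _ _))

  module ∂ x = IsLinear (∂-linear x)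

  -- Both sides sum `v` over all insertions of the two letters. The induction sorts these by whether
  -- both, one or none of the letters are put before `z`.
  ∂-comm : ∀ x y v → ∂ x (∂ y v) ≋ ∂ y (∂ x v)
  ∂-comm x y v []      = +-comm _ _
  ∂-comm x y v (z ∷ u) = begin
    (v (y ∷ x ∷ z ∷ u) + (v (x ∷ y ∷ z ∷ u) + ∂ y (λ t → v (x ∷ z ∷ t)) u))
      + ∂ x (λ t → v (y ∷ z ∷ t) + ∂ y (v ∘ (z ∷_)) t) u
      ≈⟨ +-congˡ (trans (∂.T-⊕ x (λ t → v (y ∷ z ∷ t)) (∂ y (v ∘ (z ∷_))) u)
                        (+-congˡ (∂-comm x y (v ∘ (z ∷_)) u))) ⟩
    (v (y ∷ x ∷ z ∷ u) + (v (x ∷ y ∷ z ∷ u) + ∂ y (λ t → v (x ∷ z ∷ t)) u))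
      + (∂ x (λ t → v (y ∷ z ∷ t)) u + ∂ y (∂ x (v ∘ (z ∷_))) u)
      ≈⟨ solve 5 (λ p q r s t → (p :+ (q :+ r)) :+ (s :+ t) := (q :+ (p :+ s)) :+ (r :+ t)) refl _ _ _ _ _ ⟩
    (v (x ∷ y ∷ z ∷ u) + (v (y ∷ x ∷ z ∷ u) + ∂ x (λ t → v (y ∷ z ∷ t)) u))
      + (∂ y (λ t → v (x ∷ z ∷ t)) u + ∂ y (∂ x (v ∘ (z ∷_))) u)
      ≈⟨ +-congˡ (∂.T-⊕ y (λ t → v (x ∷ z ∷ t)) (∂ x (v ∘ (z ∷_))) u) ⟨
    (v (x ∷ y ∷ z ∷ u) + (v (y ∷ x ∷ z ∷ u) + ∂ x (λ t → v (y ∷ z ∷ t)) u))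
      + ∂ y (λ t → v (x ∷ z ∷ t) + ∂ x (v ∘ (z ∷_)) t) u ∎

  -- The mirror image of the recursion defining `∂`, splitting off insertion at the right end.
  -- Reversal exchanges the two ends, so `∂-reverse` needs both forms.
  ∂-∷ʳ : ∀ x v u y → ∂ x v (u ∷ʳ y) ≈ v (u ∷ʳ y ∷ʳ x) + ∂ x (v ∘ (_∷ʳ y)) u
  ∂-∷ʳ x v []      y = +-comm _ _
  ∂-∷ʳ x v (z ∷ u) y = trans (+-congˡ (∂-∷ʳ x (v ∘ (z ∷_)) u y))
    (solve 3 (λ p q r → p :+ (q :+ r) := q :+ (p :+ r)) refl _ _ _)

  cong≈ : ∀ (v : Fun) {s t} → s ≡ t → v s ≈ v t
  cong≈ v eq = reflexive (≡.cong v eq)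

  ∂-reverse : ∀ x v u → ∂ x (v ∘ reverse) u ≈ ∂ x v (reverse u)
  ∂-reverse x v []      = refl
  ∂-reverse x v (y ∷ u) = begin
    v (reverse (x ∷ y ∷ u)) + ∂ x (λ t → v (reverse (y ∷ t))) u
      ≈⟨ +-cong (cong≈ v (≡.trans (ListP.unfold-reverse x (y ∷ u))
                                 (≡.cong (_∷ʳ x) (ListP.unfold-reverse y u))))
                (∂.T-cong x (λ t → cong≈ v (ListP.unfold-reverse y t)) u) ⟩
    v (reverse u ∷ʳ y ∷ʳ x) + ∂ x (λ t → v (reverse t ∷ʳ y)) u
      ≈⟨ +-congˡ (∂-reverse x (v ∘ (_∷ʳ y)) u) ⟩
    v (reverse u ∷ʳ y ∷ʳ x) + ∂ x (v ∘ (_∷ʳ y)) (reverse u)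
      ≈⟨ ∂-∷ʳ x v (reverse u) y ⟨
    ∂ x v (reverse u ∷ʳ y)
      ≈⟨ cong≈ (∂ x v) (ListP.unfold-reverse y u) ⟨
    ∂ x v (reverse (y ∷ u)) ∎

  -- The action of A on coefficient functions; on words it is the transpose of
  -- top-to-random.  Its value at the empty word is junk.
  toFront : Fun → Fun
  toFront v []      = 0#
  toFront v (x ∷ u) = ∂ x v u

  toFront-linear : IsLinear toFront
  toFront-linear = record { T-cong = R-cong ; T-⊕ = R-⊕ ; T-⊙ = R-⊙ }
    where
    R-cong : v ≋ w → toFront v ≋ toFront w
    R-cong eq []      = refl
    R-cong eq (x ∷ u) = ∂.T-cong x eq u

    R-⊕ : ∀ v w → toFront (v ⊕ w) ≋ toFront v ⊕ toFront w
    R-⊕ v w []      = sym (+-identityˡ 0#)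
    R-⊕ v w (x ∷ u) = ∂.T-⊕ x v w u

    R-⊙ : ∀ k v → toFront (k ⊙ v) ≋ k ⊙ toFront v
    R-⊙ k v []      = sym (zeroʳ k)
    R-⊙ k v (x ∷ u) = ∂.T-⊙ x k v u

  -- When `x` is inserted in front, `toFront` strips it again and leaves the extra `∂ x v`.
  -- Insertions behind the first letter `y` only need `∂ x` and `∂ y` to commute.
  ∂-toFront : ∀ x v → ∂ x (toFront v) ≋ ∂ x v ⊕ toFront (∂ x v)
  -- The relation holds at the empty word because the junk value of `toFront` there is 0.
  ∂-toFront x v []      = sym (+-identityʳ _)
  ∂-toFront x v (y ∷ u) = +-congˡ (∂-comm x y v u)

  -- Products of derivations and the filtration they define.

  D : List X → Fun → Fun
  D []       v = v
  D (b ∷ bs) v = ∂ b (D bs v)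

  D-linear : ∀ bs → IsLinear (D bs)
  D-linear []       = record { T-cong = λ eq → eq ; T-⊕ = λ _ _ _ → refl ; T-⊙ = λ _ _ _ → refl }
  D-linear (b ∷ bs) = record
    { T-cong = λ eq → ∂.T-cong b (IH.T-cong eq)
    ; T-⊕    = λ v w u → trans (∂.T-cong b (IH.T-⊕ v w) u) (∂.T-⊕ b (D bs v) (D bs w) u)
    ; T-⊙    = λ k v u → trans (∂.T-cong b (IH.T-⊙ k v) u) (∂.T-⊙ b k (D bs v) u)
    }
    where module IH = IsLinear (D-linear bs)

  module D bs = IsLinear (D-linear bs)

  D-reverse : ∀ bs v u → D bs (v ∘ reverse) u ≈ D bs v (reverse u)
  D-reverse []       v u = refl
  D-reverse (b ∷ bs) v u = trans (∂.T-cong b (D-reverse bs v) u) (∂-reverse b (D bs v) u)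

  -- Each derivation moved past `toFront` leaves one extra copy of the product, so the scalar counts
  -- the factors.
  D-toFront : ∀ bs v → D bs (toFront v) ≋ natK (length bs) ⊙ D bs v ⊕ toFront (D bs v)
  D-toFront []       v u = sym (trans (+-congʳ (zeroˡ _)) (+-identityˡ _))
  D-toFront (b ∷ bs) v u = begin
    ∂ b (D bs (toFront v)) u
      ≈⟨ ∂.T-cong b (D-toFront bs v) u ⟩
    ∂ b (natK (length bs) ⊙ D bs v ⊕ toFront (D bs v)) u
      ≈⟨ ∂.T-⊕ b (natK (length bs) ⊙ D bs v) (toFront (D bs v)) u ⟩
    ∂ b (natK (length bs) ⊙ D bs v) u + ∂ b (toFront (D bs v)) u
      ≈⟨ +-cong (∂.T-⊙ b (natK (length bs)) (D bs v) u) (∂-toFront b (D bs v) u) ⟩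
    natK (length bs) * ∂ b (D bs v) u + (∂ b (D bs v) u + toFront (∂ b (D bs v)) u)
      ≈⟨ solve 3 (λ m p q → m :* p :+ (p :+ q) := (con 1 :+ m) :* p :+ q) refl _ _ _ ⟩
    (1# + natK (length bs)) * ∂ b (D bs v) u + toFront (∂ b (D bs v)) u ∎

  -- In the free algebra, Killed n m cuts out of the degree n part the span of
  -- the products of Lie elements with fewer than m factors of degree 1.
  Killed : ℕ → ℕ → Fun → Set _
  Killed n m v = ∀ bs u → length bs ≡ m → m ℕ.+ length u ≡ n → D bs v u ≈ 0#

  +-length-reverse : ∀ {m n} (u : List X) → m ℕ.+ length u ≡ n → m ℕ.+ length (reverse u) ≡ n
  +-length-reverse {m} u = ≡.trans (≡.cong (m ℕ.+_) (ListP.length-reverse u))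

  killed-reverse : ∀ {n m} → Killed n m v → Killed n m (v ∘ reverse)
  killed-reverse {v} kv bs u bs≡m eq = trans (D-reverse bs v u)
    (kv bs (reverse u) bs≡m (+-length-reverse u eq))

  killed-toFront : ∀ {n m} → Killed n (suc m) v → ∀ bs u → length bs ≡ m → m ℕ.+ length u ≡ n →
                   D bs (toFront v) u ≈ natK m * D bs v u
  killed-toFront {v} kv bs u ≡.refl eq =
    trans (D-toFront bs v u) (trans (+-congˡ (vanish u eq)) (+-identityʳ _))
    where
    -- The correction term is the junk 0 at the empty word; at `x ∷ u` it is a product of one more
    -- derivation, which kills `v`.
    vanish : ∀ u → length bs ℕ.+ length u ≡ _ → toFront (D bs v) u ≈ 0#
    vanish []      eq = refl
    vanish (x ∷ u) eq = kv (x ∷ bs) u ≡.refl (≡.trans (≡.sym (ℕP.+-suc (length bs) (length u))) eq)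

  -- The common properties of the actions of w₀A and Aw₀ from which the rest is derived, so that
  -- both elements are treated at once.
  record IsFlippedShuffle (T : Fun → Fun) : Set (a ⊔ c ⊔ ℓ) where
    field
      isLinear : IsLinear T
      D-T      : ∀ {n m} → Killed n (suc m) v → ∀ bs u → length bs ≡ m → m ℕ.+ length u ≡ n →
                 D bs (T v) u ≈ natK m * D bs v (reverse u)
    open IsLinear isLinear public

  -- The action of Aw₀. Products act as composites, so w₀ is applied first; likewise
  -- `reverse∘toFront` is the action of w₀A.
  toFront∘reverse : Fun → Fun
  toFront∘reverse v = toFront (v ∘ reverse)

  reverse∘toFront : Fun → Fun
  reverse∘toFront v = toFront v ∘ reverse

  toFront∘reverse-flipped : IsFlippedShuffle toFront∘reverse
  toFront∘reverse-flipped = record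
    { isLinear = record
      { T-cong = λ eq → R.T-cong (eq ∘ reverse)
      ; T-⊕    = λ v w → R.T-⊕ (v ∘ reverse) (w ∘ reverse)
      ; T-⊙    = λ k v → R.T-⊙ k (v ∘ reverse)
      }
    ; D-T = λ {v} kv bs u p q →
        trans (killed-toFront (killed-reverse kv) bs u p q) (*-congˡ (D-reverse bs v u))
    }
    where module R = IsLinear toFront-linear

  reverse∘toFront-flipped : IsFlippedShuffle reverse∘toFront
  reverse∘toFront-flipped = record
    { isLinear = record
      { T-cong = λ eq → R.T-cong eq ∘ reverse
      ; T-⊕    = λ v w → R.T-⊕ v w ∘ reverse
      ; T-⊙    = λ k v → R.T-⊙ k v ∘ reverse
      }
    ; D-T = λ {v} kv bs u p q → trans (D-reverse bs (toFront v) u)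
        (killed-toFront kv bs (reverse u) p (+-length-reverse u q))
    }
    where module R = IsLinear toFront-linear

  killed-zero : ∀ {n} → Killed n 0 v → ∀ u → length u ≡ n → v u ≈ 0#
  killed-zero kv u eq = kv [] u ≡.refl eq

  -- Vacuous, since n + 1 derivations leave no word of total length n. This is where the descent to
  -- 0 begins.
  killed-all : ∀ {n} → Killed n (suc n) v
  killed-all {n = n} bs u _ eq =
    contradiction (ℕP.≤-trans (ℕP.m≤m+n (suc n) (length u)) (ℕP.≤-reflexive eq)) (ℕP.<-irrefl ≡.refl)

  ∂-vanish : ∀ b u → (∀ t → length t ≡ suc (length u) → v t ≈ 0#) → ∂ b v u ≈ 0#
  ∂-vanish b []      h = h _ ≡.refl
  ∂-vanish b (y ∷ u) h =
    trans (+-cong (h _ ≡.refl) (∂-vanish b u (λ t eq → h (y ∷ t) (≡.cong suc eq)))) (+-identityˡ 0#)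

  killed-suc : ∀ {n m} → Killed n m v → Killed n (suc m) v
  killed-suc {m = m} kv (b ∷ bs) u p q = ∂-vanish b u λ t eq → kv bs t (ℕP.suc-injective p)
    (≡.trans (≡.cong (m ℕ.+_) eq) (≡.trans (ℕP.+-suc m (length u)) q))

-- Integer inequalities and membership in L(n).

i-j+j≡i : ∀ i j → i ℤ.- j ℤ.+ j ≡ i
i-j+j≡i i j = ≡.trans (ℤP.+-assoc i (ℤ.- j) j)
                (≡.trans (≡.cong (λ t → i ℤ.+ t) (ℤP.+-inverseˡ j)) (ℤP.+-identityʳ i))

≤-minus⁺ : ∀ {i j} k → i ℤ.+ k ℤ.≤ j → i ℤ.≤ j ℤ.- k
≤-minus⁺ {i} {j} k le = ≡.subst (ℤ._≤ j ℤ.- k)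
  (≡.trans (ℤP.+-assoc i k (ℤ.- k)) (≡.trans (≡.cong (λ t → i ℤ.+ t) (ℤP.+-inverseʳ k)) (ℤP.+-identityʳ i)))
  (ℤP.+-monoˡ-≤ (ℤ.- k) le)

≤-minus⁻ : ∀ {i j} k → i ℤ.≤ j ℤ.- k → i ℤ.+ k ℤ.≤ j
≤-minus⁻ {i} {j} k le = ≡.subst (i ℤ.+ k ℤ.≤_) (i-j+j≡i j k) (ℤP.+-monoˡ-≤ k le)

neg≤⁺ : ∀ {i j} k → i ℤ.≤ k ℤ.+ j → ℤ.- k ℤ.+ i ℤ.≤ j
neg≤⁺ {i} {j} k le = ≡.subst (ℤ.- k ℤ.+ i ℤ.≤_)
  (≡.trans (≡.sym (ℤP.+-assoc (ℤ.- k) k j))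
    (≡.trans (≡.cong (ℤ._+ j) (ℤP.+-inverseˡ k)) (ℤP.+-identityˡ j)))
  (ℤP.+-monoʳ-≤ (ℤ.- k) le)

neg≤⁻ : ∀ {i j} k → ℤ.- k ℤ.+ i ℤ.≤ j → i ℤ.≤ k ℤ.+ j
neg≤⁻ {i} {j} k le = ≡.subst (ℤ._≤ k ℤ.+ j)
  (≡.trans (≡.sym (ℤP.+-assoc k (ℤ.- k) i))
    (≡.trans (≡.cong (ℤ._+ i) (ℤP.+-inverseʳ k)) (ℤP.+-identityˡ i)))
  (ℤP.+-monoʳ-≤ k le)

-- For a positive k the end n - 3 of the interval is the binding one, and for -k it is the end -n +
-- 4. Hence the degree n - k must be at least 3 here and at least 4 in `inL--`.
inL-+ : ∀ {n} m → 3 ℕ.+ suc m ℕ.≤ n → InL n (+ suc m)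
inL-+ {n} m le = inj₂ (inj₁
  ( neg≤⁺ (+ n) (ℤ.+≤+ (ℕP.≤-trans (ℕP.≤-trans (ℕP.m≤m+n 4 m) le) (ℕP.m≤m+n n (suc m))))
  , ≤-minus⁺ (+ 3) (ℤ.+≤+ (ℕP.≤-trans (ℕP.≤-reflexive (ℕP.+-comm (suc m) 3)) le))))

inL-- : ∀ {n} m → 4 ℕ.+ suc m ℕ.≤ n → InL n (ℤ.- + suc m)
inL-- {n} m le = inj₂ (inj₁
  ( neg≤⁺ (+ n) (≤-minus⁺ (+ suc m) (ℤ.+≤+ le))
  , ≤-minus⁺ (+ 3) (ℤP.≤-trans (ℤP.+-monoˡ-≤ (+ 3) (ℤ.-≤+ {m} {0}))
      (ℤ.+≤+ (ℕP.≤-trans (ℕP.≤-trans (ℕP.n≤1+n 3) (ℕP.m≤m+n 4 (suc m))) le)))))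

inL-0 : ∀ {n} → InL n (+ 0)
inL-0 = inj₂ (inj₂ (inj₁ ≡.refl))

inL-n : ∀ {n} → InL n (+ n)
inL-n = inj₂ (inj₂ (inj₂ ≡.refl))

neg-2+ : ∀ m → ℤ.- + (2 ℕ.+ m) ℤ.+ + 2 ≡ ℤ.- + m
neg-2+ zero    = ≡.refl
neg-2+ (suc m) = ≡.refl

inL-2-n : ∀ m → InL (m ℕ.+ 2) (ℤ.- + m)
inL-2-n m = inj₁ (≡.trans (≡.sym (neg-2+ m)) (≡.cong (λ n → ℤ.- + n ℤ.+ + 2) (ℕP.+-comm 2 m)))

-- Evaluation of polynomials at scalars, and the descent through the filtration.

module Horner {c ℓ} (F : Field c ℓ) where
  open Field F
  open FieldOps F

  horner : Poly → Carrier → Carrier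
  horner []      x = 0#
  horner (k ∷ p) x = k + x * horner p x

module FlippedShuffle {c ℓ} (F : Field c ℓ) {a} {X : Set a} {T : Words.Fun F X → Words.Fun F X}
                      (T-flipped : Words.IsFlippedShuffle F X T) where
  open Field F
  open FieldOps F
  open Words F X
  open Horner F
  open IsFlippedShuffle T-flipped
  open import Algebra.Properties.Ring ring using (-‿involutive; -‿distribˡ-*; -‿distribʳ-*; +-inverseˡ-unique)
  open import Relation.Binary.Reasoning.Setoid setoid
  open import Algebra.Solver.Ring.NaturalCoefficients.Default commutativeSemiring

  private variable
    v w : Fun
    m : ℕ

  killed-cong : v ≋ w → Killed n m v → Killed n m w
  killed-cong eq kv bs u p q = trans (sym (D.T-cong bs eq u)) (kv bs u p q)

  killed-⊕ : Killed n m v → Killed n m w → Killed n m (v ⊕ w)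
  killed-⊕ {v = v} {w} kv kw bs u p q =
    trans (D.T-⊕ bs v w u) (trans (+-cong (kv bs u p q) (kw bs u p q)) (+-identityˡ 0#))

  killed-⊙ : ∀ k → Killed n m v → Killed n m (k ⊙ v)
  killed-⊙ {v = v} k kv bs u p q =
    trans (D.T-⊙ bs k v u) (trans (*-congˡ (kv bs u p q)) (zeroʳ k))

  -- T preserves the filtration: a function killed at level m is killed at level m + 1 too, so `D-T`
  -- applies, and its right side vanishes.
  killed-T : Killed n m v → Killed n m (T v)
  killed-T {m = m} kv bs u p q = trans (D-T (killed-suc kv) bs u p q)
    (trans (*-congˡ (kv bs (reverse u) p (+-length-reverse u q))) (zeroʳ (natK m)))

  shift : Carrier → Fun → Fun
  shift k v = T v ⊕ (- k) ⊙ v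

  shift-cong : ∀ k → v ≋ w → shift k v ≋ shift k w
  shift-cong k eq u = +-cong (T-cong eq u) (*-congˡ (eq u))

  shift-comm : ∀ k l v → shift k (shift l v) ≋ shift l (shift k v)
  shift-comm k l v u = begin
    T (T v ⊕ (- l) ⊙ v) u + - k * (T v u + - l * v u)
      ≈⟨ +-congʳ (expand l) ⟩
    (T (T v) u + - l * T v u) + - k * (T v u + - l * v u)
      ≈⟨ solve 5 (λ p q r k l → (p :+ l :* q) :+ k :* (q :+ l :* r)
                             := (p :+ k :* q) :+ l :* (q :+ k :* r)) refl _ _ _ _ _ ⟩
    (T (T v) u + - k * T v u) + - l * (T v u + - k * v u)
      ≈⟨ +-congʳ (expand k) ⟨
    T (T v ⊕ (- k) ⊙ v) u + - l * (T v u + - k * v u) ∎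
    where
    expand : ∀ j → T (T v ⊕ (- j) ⊙ v) u ≈ T (T v) u + - j * T v u
    expand j = trans (T-⊕ (T v) ((- j) ⊙ v) u) (+-congˡ (T-⊙ (- j) v u))

  killed-shift : ∀ k → Killed n m v → Killed n m (shift k v)
  killed-shift k kv = killed-⊕ (killed-T kv) (killed-⊙ (- k) kv)

  shifts : List ℤ → Fun → Fun
  shifts []       v = v
  shifts (k ∷ ks) v = shift (intK k) (shifts ks v)

  shifts-cong : ∀ ks → v ≋ w → shifts ks v ≋ shifts ks w
  shifts-cong []       eq = eq
  shifts-cong (k ∷ ks) eq = shift-cong (intK k) (shifts-cong ks eq)

  shifts-shift : ∀ ks k v → shift k (shifts ks v) ≋ shifts ks (shift k v)
  shifts-shift []       k v u = refl
  shifts-shift (l ∷ ks) k v u =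
    trans (shift-comm k (intK l) (shifts ks v) u) (shift-cong (intK l) (shifts-shift ks k v) u)

  shifts-killed : ∀ ks → Killed n m v → Killed n m (shifts ks v)
  shifts-killed []       kv = kv
  shifts-killed (k ∷ ks) kv = killed-shift (intK k) (shifts-killed ks kv)

  -- The factors T - k commute, so any one of them can be applied first. The last component keeps
  -- track of the factors that are still available afterwards.
  extract : ∀ {k ks} → k ∈ ks → ∃ λ ks′ →
            (∀ v → shifts ks v ≋ shifts ks′ (shift (intK k) v)) × (∀ {l} → l ∈ ks → l ≢ k → l ∈ ks′)
  extract {ks = k ∷ ks} (here ≡.refl) =
    ks , shifts-shift ks (intK k) ,
    λ { (here l≡k) l≢k → contradiction l≡k l≢k ; (there l∈ks) _ → l∈ks }
  extract {ks = j ∷ ks} (there k∈ks) with extract k∈ks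
  ... | ks′ , eq , others =
    j ∷ ks′ , (λ v → shift-cong (intK j) (eq v)) ,
    λ { (here l≡j) _ → here l≡j ; (there l∈ks) l≢k → there (others l∈ks l≢k) }

  D-shift : ∀ k → Killed n (suc m) v → ∀ bs u → length bs ≡ m → m ℕ.+ length u ≡ n →
            D bs (shift k v) u ≈ natK m * D bs v (reverse u) + - k * D bs v u
  D-shift {v = v} k kv bs u p q =
    trans (D.T-⊕ bs (T v) ((- k) ⊙ v) u) (+-cong (D-T kv bs u p q) (D.T-⊙ bs (- k) v u))

  -- For `v` killed at level m + 1, `D-T` turns this into the statement that T acts on `v` as the
  -- scalar `k`, modulo functions killed at level m.
  EigenLevel : ℕ → ℕ → Carrier → Fun → Set _
  EigenLevel n m k v = ∀ bs u → length bs ≡ m → m ℕ.+ length u ≡ n →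
                       natK m * D bs v (reverse u) ≈ k * D bs v u

  shift-eigen : ∀ {k} → Killed n (suc m) v → EigenLevel n m k v → Killed n m (shift k v)
  shift-eigen {k = k} kv ev bs u p q = trans (D-shift k kv bs u p q)
    (trans (+-cong (ev bs u p q) (sym (-‿distribˡ-* k _))) (-‿inverseʳ _))

  -- After T + m is applied, D v becomes m times the sum of D v and its reversal. This is even
  -- because reversal is an involution, so T - m then lowers the level.
  shift-both : Killed n (suc m) v → Killed n m (shift (natK m) (shift (- natK m) v))
  shift-both {n} {m} {v} kv = shift-eigen (killed-shift (- M) kv) λ bs u p q → *-congˡ (begin
    D bs (shift (- M) v) (reverse u)
      ≈⟨ D-shift (- M) kv bs (reverse u) p (+-length-reverse u q) ⟩
    M * D bs v (reverse (reverse u)) + - - M * D bs v (reverse u)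
      ≈⟨ +-cong (*-congˡ (cong≈ (D bs v) (ListP.reverse-involutive u))) (*-congʳ (-‿involutive M)) ⟩
    M * D bs v u + M * D bs v (reverse u)
      ≈⟨ +-comm _ _ ⟩
    M * D bs v (reverse u) + M * D bs v u
      ≈⟨ +-congˡ (*-congʳ (-‿involutive M)) ⟨
    M * D bs v (reverse u) + - - M * D bs v u
      ≈⟨ D-shift (- M) kv bs u p q ⟨
    D bs (shift (- M) v) u ∎)
    where M = natK m

  level-zero : EigenLevel n 0 0# v
  level-zero bs u p q = trans (zeroˡ _) (sym (zeroˡ _))

  length≡ : ∀ {d} (u : List X) → m ℕ.+ length u ≡ m ℕ.+ d → length u ≡ d
  length≡ {m} u = ℕP.+-cancelˡ-≡ m _ _

  level-0 : EigenLevel (m ℕ.+ 0) m (natK m) v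
  level-0 {m} bs [] p q = refl
  level-0 {m} bs (x ∷ u) p q with () ← length≡ {m} (x ∷ u) q

  ∂D≈0 : Killed n (suc m) v → ∀ bs → length bs ≡ m →
         ∀ x u → suc m ℕ.+ length u ≡ n → ∂ x (D bs v) u ≈ 0#
  ∂D≈0 kv bs p x u = kv (x ∷ bs) u (≡.cong suc p)

  -- The value of D v at a single letter x is ∂ x D v at the empty word, hence 0. Degree 1 therefore
  -- costs no factor.
  killed-1 : Killed (m ℕ.+ 1) (suc m) v → Killed (m ℕ.+ 1) m v
  killed-1 {m} kv bs (x ∷ [])    p q = ∂D≈0 kv bs p x [] (≡.sym (ℕP.+-suc m 0))
  killed-1 {m} kv bs []          p q with () ← length≡ {m} [] q
  killed-1 {m} kv bs (x ∷ y ∷ u) p q with () ← length≡ {m} (x ∷ y ∷ u) q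

  -- Inserting y into the word x gives f(yx) + f(xy) = 0 for f = D v, so f is odd under reversal.
  level-2 : Killed (m ℕ.+ 2) (suc m) v → EigenLevel (m ℕ.+ 2) m (- natK m) v
  level-2 {m} {v} kv bs (x ∷ y ∷ []) p q = begin
    natK m * D bs v (y ∷ x ∷ [])        ≈⟨ *-congˡ (+-inverseˡ-unique _ _
                                            (∂D≈0 kv bs p y (x ∷ []) (≡.sym (ℕP.+-suc m 1)))) ⟩
    natK m * - D bs v (x ∷ y ∷ [])      ≈⟨ -‿distribʳ-* _ _ ⟨
    - (natK m * D bs v (x ∷ y ∷ []))    ≈⟨ -‿distribˡ-* _ _ ⟩
    - natK m * D bs v (x ∷ y ∷ [])      ∎
  level-2 {m} kv bs []              p q with () ← length≡ {m} [] q
  level-2 {m} kv bs (x ∷ [])        p q with () ← length≡ {m} (x ∷ []) q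
  level-2 {m} kv bs (x ∷ y ∷ z ∷ u) p q with () ← length≡ {m} (x ∷ y ∷ z ∷ u) q

  -- Inserting z into yx and inserting x into yz give two vanishing sums that share the terms f(yxz)
  -- and f(yzx). The remaining terms f(zyx) and f(xyz) are therefore equal.
  level-3 : Killed (m ℕ.+ 3) (suc m) v → EigenLevel (m ℕ.+ 3) m (natK m) v
  level-3 {m} {v} kv bs (x ∷ y ∷ z ∷ []) p q = *-congˡ (begin
    f z y x               ≈⟨ +-inverseˡ-unique _ _
                               (∂D≈0 kv bs p z (y ∷ x ∷ []) (≡.sym (ℕP.+-suc m 2))) ⟩
    - (f y z x + f y x z) ≈⟨ -‿cong (+-comm _ _) ⟩
    - (f y x z + f y z x) ≈⟨ +-inverseˡ-unique _ _
                               (∂D≈0 kv bs p x (y ∷ z ∷ []) (≡.sym (ℕP.+-suc m 2))) ⟨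
    f x y z               ∎)
    where
    f : X → X → X → Carrier
    f i j k = D bs v (i ∷ j ∷ k ∷ [])
  level-3 {m} kv bs []                  p q with () ← length≡ {m} [] q
  level-3 {m} kv bs (x ∷ [])            p q with () ← length≡ {m} (x ∷ []) q
  level-3 {m} kv bs (x ∷ y ∷ [])        p q with () ← length≡ {m} (x ∷ y ∷ []) q
  level-3 {m} kv bs (x ∷ y ∷ z ∷ t ∷ u) p q with () ← length≡ {m} (x ∷ y ∷ z ∷ t ∷ u) q

  -- Induction on the level m, with d = n - m the degree of D v. Only elements of absolute value at
  -- most m are required in `ks`, so the hypothesis survives the removal of the factors spent at
  -- higher levels.
  annihilate : ∀ m d → m ℕ.+ d ≡ n → ∀ ks → (∀ k → InL n k → ℤ.∣ k ∣ ℕ.≤ m → k ∈ ks) →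
               Killed n (suc m) v → Killed n 0 (shifts ks v)
  annihilate zero d eq ks ks-full kv with extract (ks-full (+ 0) inL-0 ℕ.z≤n)
  ... | ks′ , split , _ =
    killed-cong (λ u → sym (split _ u)) (shifts-killed ks′ (shift-eigen kv level-zero))
  annihilate {n} {v} (suc m) d eq ks ks-full kv = level d eq
    where
    eq′ : ∀ {d} → suc m ℕ.+ d ≡ n → m ℕ.+ suc d ≡ n
    eq′ = ≡.trans (ℕP.+-suc m _)

    smaller : ∀ {k} → ℤ.∣ k ∣ ℕ.≤ m → ∀ l → ℤ.∣ l ∣ ≡ suc m → k ≢ l
    smaller le l ∣l∣ ≡.refl = ℕP.<-irrefl ∣l∣ (ℕ.s≤s le)

    one : ∀ k → ℤ.∣ k ∣ ≡ suc m → InL n k → EigenLevel n (suc m) (intK k) v →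
          Killed n 0 (shifts ks v)
    one k ∣k∣ k∈L ev with extract (ks-full k k∈L (ℕP.≤-reflexive ∣k∣))
    ... | ks′ , split , rest = killed-cong (λ u → sym (split _ u))
      (annihilate m (suc d) (eq′ eq) ks′
        (λ l l∈L le → rest (ks-full l l∈L (ℕP.m≤n⇒m≤1+n le)) (smaller le k ∣k∣))
        (shift-eigen kv ev))

    both : InL n (+ suc m) → InL n -[1+ m ] → Killed n 0 (shifts ks v)
    both +∈L -∈L with extract (ks-full (+ suc m) +∈L ℕP.≤-refl)
    ... | ks′ , split , rest with extract (rest (ks-full -[1+ m ] -∈L ℕP.≤-refl) λ ())
    ...   | ks″ , split′ , rest′ = killed-cong
      (λ u → sym (trans (split _ u) (trans (split′ _ u) (shifts-cong ks″
                   (shift-comm (- natK (suc m)) (natK (suc m)) v) u))))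
      (annihilate m (suc d) (eq′ eq) ks″
        (λ l l∈L le → rest′ (rest (ks-full l l∈L (ℕP.m≤n⇒m≤1+n le))
                                  (smaller le (+ suc m) ≡.refl))
                            (smaller le -[1+ m ] ≡.refl))
        (shift-both kv))

    -- With k = `suc m`, degree 0 takes the factor T - k, degree 1 none, degree 2 only T + k and
    -- degree 3 only T - k. From degree 4 on both k and -k lie in L(n).
    level : ∀ d → suc m ℕ.+ d ≡ n → Killed n 0 (shifts ks v)
    level 0 ≡.refl = one (+ suc m) ≡.refl
      (≡.subst (InL n ∘ +_) (ℕP.+-identityʳ (suc m)) inL-n) level-0
    level 1 ≡.refl = annihilate m 2 (eq′ ≡.refl) ks
      (λ l l∈L le → ks-full l l∈L (ℕP.m≤n⇒m≤1+n le)) (killed-1 kv)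
    level 2 ≡.refl = one -[1+ m ] ≡.refl (inL-2-n (suc m)) (level-2 kv)
    level 3 ≡.refl = one (+ suc m) ≡.refl
      (inL-+ m (ℕP.≤-reflexive (ℕP.+-comm 3 (suc m)))) (level-3 kv)
    level (suc (suc (suc (suc d)))) ≡.refl = both
      (inL-+ m (ℕP.≤-trans (ℕP.n≤1+n _) 4+1+m≤n)) (inL-- m 4+1+m≤n)
      where
      4+1+m≤n : 4 ℕ.+ suc m ℕ.≤ suc m ℕ.+ (4 ℕ.+ d)
      4+1+m≤n = ℕP.≤-trans (ℕP.≤-reflexive (ℕP.+-comm 4 (suc m)))
                           (ℕP.+-monoʳ-≤ (suc m) (ℕP.m≤m+n 4 d))

  -- Polynomials in T and eigenfunctionals of T.

  evalT : Poly → Fun → Fun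
  evalT []      v = λ _ → 0#
  evalT (k ∷ p) v = k ⊙ v ⊕ T (evalT p v)

  evalT-addP : ∀ p q v → evalT (addP p q) v ≋ evalT p v ⊕ evalT q v
  evalT-addP []      q       v u = sym (+-identityˡ _)
  evalT-addP (k ∷ p) []      v u = sym (+-identityʳ _)
  evalT-addP (k ∷ p) (l ∷ q) v u = begin
    (k + l) * v u + T (evalT (addP p q) v) u
      ≈⟨ +-congˡ (trans (T-cong (evalT-addP p q v) u) (T-⊕ (evalT p v) (evalT q v) u)) ⟩
    (k + l) * v u + (T (evalT p v) u + T (evalT q v) u)
      ≈⟨ solve 5 (λ k l x p q → (k :+ l) :* x :+ (p :+ q) := (k :* x :+ p) :+ (l :* x :+ q))
               refl _ _ _ _ _ ⟩
    (k * v u + T (evalT p v) u) + (l * v u + T (evalT q v) u) ∎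

  evalT-map : ∀ k p v → evalT (map (k *_) p) v ≋ k ⊙ evalT p v
  evalT-map k []      v u = sym (zeroʳ k)
  evalT-map k (l ∷ p) v u = begin
    (k * l) * v u + T (evalT (map (k *_) p) v) u
      ≈⟨ +-congˡ (trans (T-cong (evalT-map k p v) u) (T-⊙ k (evalT p v) u)) ⟩
    (k * l) * v u + k * T (evalT p v) u
      ≈⟨ solve 4 (λ k l x y → (k :* l) :* x :+ k :* y := k :* (l :* x :+ y)) refl _ _ _ _ ⟩
    k * (l * v u + T (evalT p v) u) ∎

  evalT-0∷ : ∀ p v → evalT (0# ∷ p) v ≋ T (evalT p v)
  evalT-0∷ p v u = trans (+-congʳ (zeroˡ _)) (+-identityˡ _)

  evalT-linear : ∀ k p v → evalT (mulP (linear k) p) v ≋ shift k (evalT p v)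
  evalT-linear k p v u = begin
    evalT (addP (map (- k *_) p) (0# ∷ mulP (1# ∷ []) p)) v u
      ≈⟨ evalT-addP (map (- k *_) p) (0# ∷ mulP (1# ∷ []) p) v u ⟩
    evalT (map (- k *_) p) v u + evalT (0# ∷ mulP (1# ∷ []) p) v u
      ≈⟨ +-cong (evalT-map (- k) p v u)
                (trans (evalT-0∷ (mulP (1# ∷ []) p) v u) (T-cong unit u)) ⟩
    - k * evalT p v u + T (evalT p v) u
      ≈⟨ +-comm _ _ ⟩
    T (evalT p v) u + - k * evalT p v u ∎
    where
    unit : evalT (mulP (1# ∷ []) p) v ≋ evalT p v
    unit u = begin
      evalT (addP (map (1# *_) p) (0# ∷ [])) v u
        ≈⟨ evalT-addP (map (1# *_) p) (0# ∷ []) v u ⟩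
      evalT (map (1# *_) p) v u + evalT (0# ∷ []) v u
        ≈⟨ +-cong (trans (evalT-map 1# p v u) (*-identityˡ _)) (trans (evalT-0∷ [] v u) (T-0 u)) ⟩
      evalT p v u + 0#
        ≈⟨ +-identityʳ _ ⟩
      evalT p v u ∎

  evalT-prodP : ∀ ks v → evalT (prodP (map intK ks)) v ≋ shifts ks v
  evalT-prodP []       v u = trans (+-congˡ (T-0 u)) (trans (+-identityʳ _) (*-identityˡ _))
  evalT-prodP (k ∷ ks) v u =
    trans (evalT-linear (intK k) (prodP (map intK ks)) v u) (shift-cong (intK k) (evalT-prodP ks v) u)

  killed-evalT : ∀ p → Killed n m v → Killed n m (evalT p v)
  killed-evalT []      kv bs u p q = D.T-0 bs u
  killed-evalT (k ∷ p) kv = killed-⊕ (killed-⊙ k kv) (killed-T (killed-evalT p kv))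

  module _ {ε} (ε²≈1 : ε * ε ≈ 1#) {bs u : List X} (bs≡m : length bs ≡ m) (m+u≡n : m ℕ.+ length u ≡ n) where
    -- The functional extracting the ε-part of D v under reversal at `u`. On functions killed at
    -- level m + 1 it is an eigenfunctional of T with eigenvalue ε m.
    ψ : Fun → Carrier
    ψ v = D bs v u + ε * D bs v (reverse u)

    ψ-T : Killed n (suc m) v → ψ (T v) ≈ (ε * natK m) * ψ v
    ψ-T {v} kv = begin
      D bs (T v) u + ε * D bs (T v) (reverse u)
        ≈⟨ +-cong (D-T kv bs u bs≡m m+u≡n)
                  (*-congˡ (trans (D-T kv bs (reverse u) bs≡m (+-length-reverse u m+u≡n))
                                  (*-congˡ (cong≈ (D bs v) (ListP.reverse-involutive u))))) ⟩
      natK m * D bs v (reverse u) + ε * (natK m * D bs v u)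
        ≈⟨ +-congʳ (trans (*-congʳ ε²≈1) (*-identityˡ _)) ⟨
      (ε * ε) * (natK m * D bs v (reverse u)) + ε * (natK m * D bs v u)
        ≈⟨ solve 4 (λ ε m x y → (ε :* ε) :* (m :* y) :+ ε :* (m :* x)
                             := (ε :* m) :* (x :+ ε :* y)) refl _ _ _ _ ⟩
      (ε * natK m) * ψ v ∎

    -- Since T preserves the filtration, `ψ-T` can be iterated: under `ψ`, a polynomial in T becomes
    -- its value at the eigenvalue.
    ψ-evalT : ∀ p → Killed n (suc m) v → ψ (evalT p v) ≈ horner p (ε * natK m) * ψ v
    ψ-evalT []      kv = begin
      D bs (λ _ → 0#) u + ε * D bs (λ _ → 0#) (reverse u) ≈⟨ +-cong (D.T-0 bs u) (*-congˡ (D.T-0 bs (reverse u))) ⟩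
      0# + ε * 0#                                         ≈⟨ trans (+-identityˡ _) (zeroʳ ε) ⟩
      0#                                                  ≈⟨ zeroˡ _ ⟨
      0# * ψ _                                            ∎
    ψ-evalT {v} (k ∷ p) kv = begin
      D bs (k ⊙ v ⊕ T v′) u + ε * D bs (k ⊙ v ⊕ T v′) (reverse u)
        ≈⟨ +-cong (split u) (*-congˡ (split (reverse u))) ⟩
      (k * D bs v u + D bs (T v′) u) + ε * (k * D bs v (reverse u) + D bs (T v′) (reverse u))
        ≈⟨ solve 6 (λ k ε a b c d → (k :* a :+ b) :+ ε :* (k :* c :+ d)
                                 := k :* (a :+ ε :* c) :+ (b :+ ε :* d)) refl _ _ _ _ _ _ ⟩
      k * ψ v + ψ (T v′)
        ≈⟨ +-congˡ (trans (ψ-T (killed-evalT p kv)) (*-congˡ (ψ-evalT p kv))) ⟩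
      k * ψ v + (ε * natK m) * (horner p (ε * natK m) * ψ v)
        ≈⟨ solve 4 (λ k x h y → k :* y :+ x :* (h :* y) := (k :+ x :* h) :* y) refl _ _ _ _ ⟩
      (k + (ε * natK m) * horner p (ε * natK m)) * ψ v ∎
      where
      v′ = evalT p v
      split : ∀ u → D bs (k ⊙ v ⊕ T v′) u ≈ k * D bs v u + D bs (T v′) u
      split u = trans (D.T-⊕ bs (k ⊙ v) (T v′) u) (+-congʳ (D.T-⊙ bs k v u))

-- Finite sums.

module Sums {c ℓ} (F : Field c ℓ) where
  open Field F
  open import Relation.Binary.Reasoning.Setoid setoid
  open import Algebra.Properties.CommutativeSemigroup +-commutativeSemigroup using (interchange)

  ∑ : {A : Set} → List A → (A → Carrier) → Carrier
  ∑ xs f = foldr (λ x r → f x + r) 0# xs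

  module _ {A : Set} where

    ∑-cong : ∀ (xs : List A) {f g} → (∀ {x} → x ∈ xs → f x ≈ g x) → ∑ xs f ≈ ∑ xs g
    ∑-cong []       eq = refl
    ∑-cong (x ∷ xs) eq = +-cong (eq (here ≡.refl)) (∑-cong xs (eq ∘ there))

    ∑-0 : ∀ (xs : List A) → ∑ xs (λ _ → 0#) ≈ 0#
    ∑-0 []       = refl
    ∑-0 (x ∷ xs) = trans (+-identityˡ _) (∑-0 xs)

    ∑-+ : ∀ (xs : List A) f g → ∑ xs (λ x → f x + g x) ≈ ∑ xs f + ∑ xs g
    ∑-+ []       f g = sym (+-identityˡ 0#)
    ∑-+ (x ∷ xs) f g = trans (+-congˡ (∑-+ xs f g)) (interchange _ _ _ _)

    ∑-*ˡ : ∀ (xs : List A) k f → ∑ xs (λ x → k * f x) ≈ k * ∑ xs f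
    ∑-*ˡ []       k f = sym (zeroʳ k)
    ∑-*ˡ (x ∷ xs) k f = trans (+-congˡ (∑-*ˡ xs k f)) (sym (distribˡ k _ _))

    ∑-*ʳ : ∀ (xs : List A) k f → ∑ xs (λ x → f x * k) ≈ ∑ xs f * k
    ∑-*ʳ xs k f = trans (∑-cong xs (λ _ → *-comm _ k)) (trans (∑-*ˡ xs k f) (*-comm k _))

    ∑-map : ∀ {B : Set} (h : B → A) xs f → ∑ (map h xs) f ≡ ∑ xs (f ∘ h)
    ∑-map h []       f = ≡.refl
    ∑-map h (x ∷ xs) f = ≡.cong (λ s → f (h x) + s) (∑-map h xs f)

    module _ (_≟_ : DecidableEquality A) (f : A → Carrier) where

      ∑-none : ∀ {xs y} → All (y ≢_) xs → ∑ xs (λ x → if does (y ≟ x) then f x else 0#) ≈ 0#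
      ∑-none []                        = refl
      ∑-none {x ∷ xs} {y} (y≢x ∷ y∉xs) with y ≟ x
      ... | yes y≡x = contradiction y≡x y≢x
      ... | no _    = trans (+-identityˡ _) (∑-none y∉xs)

      ∑-single : ∀ {xs y} → Unique xs → y ∈ xs →
                 ∑ xs (λ x → if does (y ≟ x) then f x else 0#) ≈ f y
      ∑-single {x ∷ xs} {y} (x∉xs ∷ uniq) y∈ with y ≟ x | y∈
      ... | yes ≡.refl | _          = trans (+-congˡ (∑-none x∉xs)) (+-identityʳ _)
      ... | no y≢x     | here y≡x   = contradiction y≡x y≢x
      ... | no _       | there y∈xs = trans (+-identityˡ _) (∑-single uniq y∈xs)

  ∑-swap : ∀ {A B : Set} (xs : List A) (ys : List B) (f : A → B → Carrier) →
           ∑ xs (λ x → ∑ ys (f x)) ≈ ∑ ys (λ y → ∑ xs (λ x → f x y))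
  ∑-swap []       ys f = sym (∑-0 ys)
  ∑-swap (x ∷ xs) ys f = trans (+-congˡ (∑-swap xs ys f)) (sym (∑-+ ys (f x) _))

  if-* : ∀ b x y → (if b then x else 0#) * y ≈ (if b then x * y else 0#)
  if-* true  x y = refl
  if-* false x y = zeroˡ y

-- The group algebra acting on functions on words.

module PlaceAction {c ℓ} (F : Field c ℓ) (n : ℕ) {X : Set} where
  open Field F
  open GroupAlgebra F n
  open Sums F
  open Words F X
  open import Relation.Binary.Reasoning.Setoid setoid

  _≟ₚ_ : DecidableEquality Perm
  _≟ₚ_ = VecP.≡-dec FinP._≟_

  place : KS → (Vec X n → Carrier) → Vec X n → Carrier
  place b V u = ∑ (perms n) (λ σ → b σ * V (act u σ))

  place-cong : ∀ b {V W} → (∀ u → V u ≈ W u) → ∀ u → place b V u ≈ place b W u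
  place-cong b eq u = ∑-cong (perms n) (λ {σ} _ → *-congˡ (eq (act u σ)))

  place-+ : ∀ a b V u → place (a +ₐ b) V u ≈ place a V u + place b V u
  place-+ a b V u = trans (∑-cong (perms n) (λ _ → distribʳ _ _ _)) (∑-+ (perms n) _ _)

  ∑-δ : ∀ {π} → π ∈ perms n → ∀ (f : Perm → Carrier) → ∑ (perms n) (λ σ → δ π σ * f σ) ≈ f π
  ∑-δ {π} π∈ f = begin
    ∑ (perms n) (λ σ → δ π σ * f σ)
      ≈⟨ ∑-cong (perms n) (λ {σ} _ → if-* (does (π ≟ₚ σ)) 1# (f σ)) ⟩
    ∑ (perms n) (λ σ → if does (π ≟ₚ σ) then 1# * f σ else 0#)
      ≈⟨ ∑-single _≟ₚ_ (λ σ → 1# * f σ) (perms-unique n) π∈ ⟩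
    1# * f π
      ≈⟨ *-identityˡ _ ⟩
    f π ∎

  place-δ : ∀ {π} → π ∈ perms n → ∀ V u → place (δ π) V u ≈ V (act u π)
  place-δ π∈ V u = ∑-δ π∈ (V ∘ act u)

  place-scalar : ∀ k V u → place (scalar k) V u ≈ k * V u
  place-scalar k V u = begin
    ∑ (perms n) (λ σ → (k * δ (tabulate id) σ) * V (act u σ))
      ≈⟨ ∑-cong (perms n) (λ _ → *-assoc k _ _) ⟩
    ∑ (perms n) (λ σ → k * (δ (tabulate id) σ * V (act u σ)))
      ≈⟨ ∑-*ˡ (perms n) k _ ⟩
    k * place (δ (tabulate id)) V u
      ≈⟨ *-congˡ (place-δ id∈perms V u) ⟩
    k * V (act u (tabulate id))
      ≈⟨ *-congˡ (reflexive (≡.cong V (act-id u))) ⟩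
    k * V u ∎

  -- Permutations act on words from the right, hence on functions from the left. For fixed ρ and τ,
  -- the sum over σ has a single nonzero summand at most, at the product of ρ and τ, which is again
  -- in `perms n`.
  place-* : ∀ a b V u → place (a *ₐ b) V u ≈ place a (place b V) u
  place-* a b V u = begin
    ∑ P (λ σ → ∑ P (λ ρ → ∑ P (λ τ → term ρ τ σ)) * V (act u σ))
      ≈⟨ ∑-cong P (λ {σ} _ → trans (sym (∑-*ʳ P _ _)) (∑-cong P λ _ → sym (∑-*ʳ P _ _))) ⟩
    ∑ P (λ σ → ∑ P (λ ρ → ∑ P (λ τ → term ρ τ σ * V (act u σ))))
      ≈⟨ ∑-swap P P _ ⟩
    ∑ P (λ ρ → ∑ P (λ σ → ∑ P (λ τ → term ρ τ σ * V (act u σ))))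
      ≈⟨ ∑-cong P (λ {ρ} ρ∈ → begin
           ∑ P (λ σ → ∑ P (λ τ → term ρ τ σ * V (act u σ)))
             ≈⟨ ∑-swap P P _ ⟩
           ∑ P (λ τ → ∑ P (λ σ → term ρ τ σ * V (act u σ)))
             ≈⟨ ∑-cong P (λ {τ} τ∈ → collapse ρ∈ τ∈) ⟩
           ∑ P (λ τ → a ρ * (b τ * V (act (act u ρ) τ)))
             ≈⟨ ∑-*ˡ P (a ρ) _ ⟩
           a ρ * place b V (act u ρ) ∎) ⟩
    ∑ P (λ ρ → a ρ * place b V (act u ρ)) ∎
    where
    P = perms n
    term : Perm → Perm → Perm → Carrier
    term ρ τ σ = if does ((ρ ∘ₚ τ) ≟ₚ σ) then a ρ * b τ else 0#

    collapse : ∀ {ρ τ} → ρ ∈ P → τ ∈ P →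
               ∑ P (λ σ → term ρ τ σ * V (act u σ)) ≈ a ρ * (b τ * V (act (act u ρ) τ))
    collapse {ρ} {τ} ρ∈ τ∈ = begin
      ∑ P (λ σ → term ρ τ σ * V (act u σ))
        ≈⟨ ∑-cong P (λ {σ} _ → if-* (does ((ρ ∘ₚ τ) ≟ₚ σ)) _ _) ⟩
      ∑ P (λ σ → if does ((ρ ∘ₚ τ) ≟ₚ σ) then (a ρ * b τ) * V (act u σ) else 0#)
        ≈⟨ ∑-single _≟ₚ_ (λ σ → (a ρ * b τ) * V (act u σ)) (perms-unique n) (∘ₚ-∈ ρ∈ τ∈) ⟩
      (a ρ * b τ) * V (act u (ρ ∘ₚ τ))
        ≈⟨ *-assoc _ _ _ ⟩
      a ρ * (b τ * V (act u (ρ ∘ₚ τ)))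
        ≈⟨ *-congˡ (*-congˡ (reflexive (≡.cong V (act-∘ₚ u ρ τ)))) ⟩
      a ρ * (b τ * V (act (act u ρ) τ)) ∎

  place-W₀ : ∀ v (u : Vec X n) → place W₀ (v ∘ toList) u ≈ v (reverse (toList u))
  place-W₀ v u = trans (place-δ w₀∈perms (v ∘ toList) u) (reflexive (≡.cong v (toList-act-w₀ u)))

module _ {c ℓ} (F : Field c ℓ) {X : Set} where
  open Field F
  open Sums F
  open Words F X
  open import Relation.Binary.Reasoning.Setoid setoid

  ∑-insertAt : ∀ {n} x v (u : Vec X n) →
               ∑ (List.allFin (suc n)) (λ i → v (toList (insertAt u i x))) ≈ ∂ x v (toList u)
  ∑-insertAt         x v []      = +-identityʳ _
  ∑-insertAt {suc n} x v (y ∷ u) = +-congˡ (begin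
    ∑ (List.tabulate suc) f               ≡⟨ ≡.cong (λ is → ∑ is f) (ListP.map-tabulate id suc) ⟨
    ∑ (map suc (List.allFin (suc n))) f   ≡⟨ ∑-map suc (List.allFin (suc n)) f ⟩
    ∑ (List.allFin (suc n)) (f ∘ suc)     ≈⟨ ∑-insertAt x (v ∘ (y ∷_)) u ⟩
    ∂ x (v ∘ (y ∷_)) (toList u)           ∎)
    where
    f : Fin (suc (suc n)) → Carrier
    f i = v (toList (insertAt (y ∷ u) i x))

  -- The i-th summand of A moves the first letter x of the word to place i. Summed over i, this
  -- inserts x at all places of the remaining word, which is what `∂ x` does.
  place-A : ∀ n v (u : Vec X n) →
            PlaceAction.place F n (GroupAlgebra.A F n) (v ∘ toList) u ≈ toFront v (toList u)
  place-A n v u = begin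
    ∑ (perms n) (λ σ → ∑ (map cycle (List.allFin n)) (λ π → δ π σ) * V (act u σ))
      ≈⟨ ∑-cong (perms n) (λ {σ} _ → trans (*-congʳ (reflexive (∑-map cycle (List.allFin n) (λ π → δ π σ))))
                                           (sym (∑-*ʳ (List.allFin n) _ _))) ⟩
    ∑ (perms n) (λ σ → ∑ (List.allFin n) (λ i → δ (cycle i) σ * V (act u σ)))
      ≈⟨ ∑-swap (perms n) (List.allFin n) _ ⟩
    ∑ (List.allFin n) (λ i → place (δ (cycle i)) V u)
      ≈⟨ ∑-cong (List.allFin n) (λ {i} _ → place-δ (cycle∈perms i) V u) ⟩
    ∑ (List.allFin n) (λ i → V (act u (cycle i)))
      ≈⟨ moves n u ⟩
    toFront v (toList u) ∎
    where
    open PlaceAction F n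
    open GroupAlgebra F n using (δ)
    V : ∀ {n} → Vec X n → Carrier
    V = v ∘ toList

    moves : ∀ n (u : Vec X n) → ∑ (List.allFin n) (λ i → V (act u (cycle i))) ≈ toFront v (toList u)
    -- A is an empty sum for length 0, in agreement with the junk value of `toFront`.
    moves zero    []      = refl
    moves (suc n) (x ∷ u) = trans
      (∑-cong (List.allFin (suc n)) (λ {i} _ → reflexive (≡.cong V (act-cycle u i x))))
      (∑-insertAt x v u)

-- Monic polynomials and their roots.

module Polynomials {c ℓ} (F : Field c ℓ) where
  open Field F
  open Horner F
  open FieldOps F
  open import Algebra.Properties.Ring ring using (-‿involutive; -‿distribˡ-*; +-inverseˡ-unique; +-cancelˡ)
  open import Relation.Binary.Reasoning.Setoid setoid
  open import Algebra.Solver.Ring.NaturalCoefficients.Default commutativeSemiring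

  -- `MonicOfDegree` exposes the last coefficient; this form follows the recursion from the lowest
  -- coefficient that `addP`, `mulP` and `quotient` use.
  data Monic : ℕ → Poly → Set (c ⊔ ℓ) where
    [_] : ∀ {k} → k ≈ 1# → Monic 0 (k ∷ [])
    _∷_ : ∀ {d p} k → Monic d p → Monic (suc d) (k ∷ p)

  fromMonicOfDegree : ∀ {d p} → MonicOfDegree d p → Monic d p
  fromMonicOfDegree ([]     , lc , ≡.refl , ≡.refl , lc≈1) = [ lc≈1 ]
  fromMonicOfDegree (k ∷ cs , lc , ≡.refl , ≡.refl , lc≈1) =
    k ∷ fromMonicOfDegree (cs , lc , ≡.refl , ≡.refl , lc≈1)

  toMonicOfDegree : ∀ {d p} → Monic d p → MonicOfDegree d p
  toMonicOfDegree [ k≈1 ]   = [] , _ , ≡.refl , ≡.refl , k≈1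
  toMonicOfDegree (k ∷ mon) with toMonicOfDegree mon
  ... | cs , lc , ≡.refl , ≡.refl , lc≈1 = k ∷ cs , lc , ≡.refl , ≡.refl , lc≈1

  monic-unit : ∀ {d p} → Monic d p → Monic d (mulP (1# ∷ []) p)
  monic-unit [ k≈1 ]   = [ trans (+-identityʳ _) (trans (*-identityˡ _) k≈1) ]
  monic-unit (k ∷ mon) = _ ∷ scale mon
    where
    scale : ∀ {d p} → Monic d p → Monic d (addP (map (1# *_) p) [])
    scale [ k≈1 ]   = [ trans (*-identityˡ _) k≈1 ]
    scale (k ∷ mon) = _ ∷ ≡.subst (Monic _) (addP-[] _) (scale mon)
      where
      addP-[] : ∀ p → addP p [] ≡ p
      addP-[] []      = ≡.refl
      addP-[] (_ ∷ _) = ≡.refl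

  -- The list `p` is one entry too short to reach the leading coefficient of `q`.
  monic-addP : ∀ {d q} p → length p ≡ d → Monic d q → Monic d (addP p q)
  monic-addP []      _  mon       = mon
  monic-addP (k ∷ p) eq (l ∷ mon) = _ ∷ monic-addP p (ℕP.suc-injective eq) mon

  monic-length : ∀ {d p} → Monic d p → length p ≡ suc d
  monic-length [ _ ]     = ≡.refl
  monic-length (_ ∷ mon) = ≡.cong suc (monic-length mon)

  monic-linear : ∀ {d p} k → Monic d p → Monic (suc d) (mulP (linear k) p)
  monic-linear {p = p} k mon = monic-addP (map (- k *_) p)
    (≡.trans (ListP.length-map _ p) (monic-length mon)) (0# ∷ monic-unit mon)

  monic-prodP : ∀ ks → Monic (length ks) (prodP ks)
  monic-prodP []       = [ refl ]
  monic-prodP (k ∷ ks) = monic-linear k (monic-prodP ks)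

  noZeroDivisors : ∀ {x y} → ¬ (x ≈ 0#) → x * y ≈ 0# → y ≈ 0#
  noZeroDivisors {x} {y} x≉0 xy≈0 with inverse x x≉0
  ... | x⁻¹ , eq = begin
    y               ≈⟨ *-identityˡ y ⟨
    1# * y          ≈⟨ *-congʳ eq ⟨
    (x * x⁻¹) * y   ≈⟨ solve 3 (λ x z y → (x :* z) :* y := z :* (x :* y)) refl _ _ _ ⟩
    x⁻¹ * (x * y)   ≈⟨ *-congˡ xy≈0 ⟩
    x⁻¹ * 0#        ≈⟨ zeroʳ _ ⟩
    0#              ∎

  -- Synthetic division by x - r: the coefficients of the quotient are the Horner values at r of the
  -- proper tails of the list.
  quotient : Carrier → Poly → Poly
  quotient r []          = []
  quotient r (k ∷ [])    = []
  quotient r (k ∷ l ∷ p) = horner (l ∷ p) r ∷ quotient r (l ∷ p)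

  quotient-monic : ∀ {d p} r → Monic (suc d) p → Monic d (quotient r p)
  quotient-monic r (k ∷ [ l≈1 ])     = [ trans (+-congˡ (zeroʳ r)) (trans (+-identityʳ _) l≈1) ]
  quotient-monic r (k ∷ (l ∷ [ e ])) = _ ∷ quotient-monic r (l ∷ [ e ])
  quotient-monic r (k ∷ (l ∷ (j ∷ mon))) = _ ∷ quotient-monic r (l ∷ (j ∷ mon))

  -- Stated without subtraction, so that every step is a semiring identity.
  horner-quotient : ∀ r p x → horner p x + r * horner (quotient r p) x
                            ≈ x * horner (quotient r p) x + horner p r
  horner-quotient r []          x = solve 2 (λ r x → con 0 :+ r :* con 0 := x :* con 0 :+ con 0) refl r x
  horner-quotient r (k ∷ [])    x =
    solve 3 (λ r x k → (k :+ x :* con 0) :+ r :* con 0 := x :* con 0 :+ (k :+ r :* con 0)) refl r x k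
  horner-quotient r (k ∷ l ∷ p) x = begin
    (k + x * P) + r * (Pr + x * Q)   ≈⟨ solve 6 (λ k x P r R Q → (k :+ x :* P) :+ r :* (R :+ x :* Q)
                                          := k :+ (x :* (P :+ r :* Q) :+ r :* R)) refl _ _ _ _ _ _ ⟩
    k + (x * (P + r * Q) + r * Pr)   ≈⟨ +-congˡ (+-congʳ (*-congˡ (horner-quotient r (l ∷ p) x))) ⟩
    k + (x * (x * Q + Pr) + r * Pr)  ≈⟨ solve 5 (λ k x r R Q → k :+ (x :* (x :* Q :+ R) :+ r :* R)
                                          := x :* (R :+ x :* Q) :+ (k :+ r :* R)) refl _ _ _ _ _ ⟩
    x * (Pr + x * Q) + (k + r * Pr)  ∎
    where
    P = horner (l ∷ p) x
    Pr = horner (l ∷ p) r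
    Q = horner (quotient r (l ∷ p)) x

  -- Divide by x - k for the first root k. Any other root l remains a root of the quotient because l
  -- - k is invertible.
  roots≤degree : ∀ {d p} → Monic d p → ∀ ks → All (λ k → horner p k ≈ 0#) ks →
                 AllPairs (λ k l → ¬ (k ≈ l)) ks → length ks ℕ.≤ d
  roots≤degree mon       []       _              _                = ℕ.z≤n
  roots≤degree [ l≈1 ]   (k ∷ ks) (root ∷ _)     _                =
    contradiction (trans (sym (trans (+-congˡ (zeroʳ k)) (trans (+-identityʳ _) l≈1))) root) 1≉0
  roots≤degree {p = p} mon@(_ ∷ _) (k ∷ ks) (root ∷ roots) (k≉ks ∷ distinct) =
    ℕ.s≤s (roots≤degree (quotient-monic k mon) ks
      (All.zipWith (λ { (k≉l , root-l) → step k≉l root-l }) (k≉ks , roots)) distinct)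
    where
    step : ∀ {l} → ¬ (k ≈ l) → horner p l ≈ 0# → horner (quotient k p) l ≈ 0#
    step {l} k≉l root-l = noZeroDivisors l-k≉0 (begin
      (l + - k) * Q       ≈⟨ distribʳ Q l (- k) ⟩
      l * Q + - k * Q     ≈⟨ +-cong lQ≈kQ (sym (-‿distribˡ-* k Q)) ⟩
      k * Q + - (k * Q)   ≈⟨ -‿inverseʳ _ ⟩
      0#                  ∎)
      where
      Q = horner (quotient k p) l
      lQ≈kQ : l * Q ≈ k * Q
      lQ≈kQ = begin
        l * Q                 ≈⟨ +-identityʳ _ ⟨
        l * Q + 0#            ≈⟨ +-congˡ root ⟨
        l * Q + horner p k    ≈⟨ horner-quotient k p l ⟨
        horner p l + k * Q    ≈⟨ +-congʳ root-l ⟩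
        0# + k * Q            ≈⟨ +-identityˡ _ ⟩
        k * Q                 ∎
      l-k≉0 : ¬ (l + - k ≈ 0#)
      l-k≉0 eq = k≉l (sym (trans (+-inverseˡ-unique l (- k) eq) (-‿involutive k)))

  natK-+ : ∀ m n → natK (m ℕ.+ n) ≈ natK m + natK n
  natK-+ zero    n = sym (+-identityˡ _)
  natK-+ (suc m) n = trans (+-congˡ (natK-+ m n)) (sym (+-assoc _ _ _))

  module _ (char0 : CharZero) where

    natK-injective : ∀ m n → natK m ≈ natK n → m ≡ n
    natK-injective zero    zero    _  = ≡.refl
    natK-injective zero    (suc n) eq = contradiction (sym eq) (char0 n)
    natK-injective (suc m) zero    eq = contradiction eq (char0 m)
    natK-injective (suc m) (suc n) eq = ≡.cong suc (natK-injective m n (+-cancelˡ 1# _ _ eq))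

    natK≉-natK : ∀ m n → ¬ (natK m ≈ - natK (suc n))
    natK≉-natK m n eq = char0 (n ℕ.+ m) (trans (natK-+ (suc n) m)
      (trans (+-congˡ eq) (-‿inverseʳ _)))

    intK-injective : ∀ i j → intK i ≈ intK j → i ≡ j
    intK-injective (+ m)    (+ n)    eq = ≡.cong +_ (natK-injective m n eq)
    intK-injective (+ m)    -[1+ n ] eq = contradiction eq (natK≉-natK m n)
    intK-injective -[1+ m ] (+ n)    eq = contradiction (sym eq) (natK≉-natK n m)
    intK-injective -[1+ m ] -[1+ n ] eq = ≡.cong -[1+_] (ℕP.suc-injective (natK-injective (suc m) (suc n)
      (trans (sym (-‿involutive _)) (trans (-‿cong eq) (-‿involutive _)))))

-- Commutators in two letters, and L(n) as a set of eigenvalues.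

module Eigenvectors {c ℓ} (F : Field c ℓ) (char0 : FieldOps.CharZero F) where
  open Field F
  open FieldOps F
  open Horner F
  open Polynomials F
  open Words F Bool
  open import Algebra.Properties.Ring ring using (-‿involutive; -1*x≈-x)
  open import Relation.Binary.Reasoning.Setoid setoid
  open import Algebra.Solver.Ring.NaturalCoefficients.Default commutativeSemiring

  private variable
    v w : Fun
    d : ℕ
    ε ε′ : Carrier

  pattern a = true
  pattern b = false

  same : Bool → Bool → Carrier
  same x y = if does (x Bool.≟ y) then 1# else 0#

  infixr 8 _·_
  -- Left multiplication by a letter in the free algebra, on coefficient functions; `∂-·` is the
  -- Leibniz rule for it.
  _·_ : Bool → Fun → Fun
  (x · v) []      = 0#
  (x · v) (y ∷ u) = same x y * v u

  ·-cong : ∀ x → v ≋ w → x · v ≋ x · w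
  ·-cong x eq []      = refl
  ·-cong x eq (y ∷ u) = *-congˡ (eq u)

  ·-⊙ : ∀ x k v → x · (k ⊙ v) ≋ k ⊙ (x · v)
  ·-⊙ x k v []      = sym (zeroʳ k)
  ·-⊙ x k v (y ∷ u) = solve 3 (λ s k v → s :* (k :* v) := k :* (s :* v)) refl _ _ _

  ∂-· : ∀ y x v → ∂ y (x · v) ≋ same x y ⊙ v ⊕ x · ∂ y v
  ∂-· y x v []      = sym (+-identityʳ _)
  ∂-· y x v (z ∷ u) = +-congˡ (∂.T-⊙ y (same x z) v u)

  Closed : Fun → Set _
  Closed v = ∀ x → ∂ x v ≋ (λ _ → 0#)

  ∂-·-closed : Closed v → ∀ y x → ∂ y (x · v) ≋ same x y ⊙ v
  ∂-·-closed {v} cv y x u = begin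
    ∂ y (x · v) u                        ≈⟨ ∂-· y x v u ⟩
    same x y * v u + (x · ∂ y v) u       ≈⟨ +-congˡ (trans (·-cong x 0≋ u) (·-⊙ x 0# (λ _ → 0#) u)) ⟩
    same x y * v u + 0# * (x · _) u      ≈⟨ trans (+-congˡ (zeroˡ _)) (+-identityʳ _) ⟩
    same x y * v u                       ∎
    where
    0≋ : ∂ y v ≋ 0# ⊙ (λ _ → 0#)
    0≋ t = trans (cv y t) (sym (zeroˡ 0#))

  x-x≈0 : ∀ x → x + - 1# * x ≈ 0#
  x-x≈0 x = trans (+-congˡ (-1*x≈-x x)) (-‿inverseʳ x)

  one : Fun
  one []      = 1#
  one (_ ∷ _) = 0#

  one-closed : Closed one
  one-closed x []      = refl
  one-closed x (y ∷ u) = trans (+-identityˡ _) (∂.T-0 x u)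

  [ab]· : Fun → Fun
  [ab]· v = a · b · v ⊕ (- 1#) ⊙ (b · a · v)

  -- For closed `v`, the Leibniz rule gives the same two terms for a b v and b a v, in opposite
  -- orders.
  [ab]·-closed : Closed v → Closed ([ab]· v)
  [ab]·-closed {v} cv x u = begin
    ∂ x ([ab]· v) u
      ≈⟨ trans (∂.T-⊕ x (a · b · v) _ u) (+-congˡ (∂.T-⊙ x (- 1#) (b · a · v) u)) ⟩
    ∂ x (a · b · v) u + - 1# * ∂ x (b · a · v) u
      ≈⟨ +-cong (twice a b) (*-congˡ (trans (twice b a) (+-comm _ _))) ⟩
    (same a x * (b · v) u + same b x * (a · v) u) + - 1# * (same a x * (b · v) u + same b x * (a · v) u)
      ≈⟨ x-x≈0 _ ⟩
    0# ∎
    where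
    twice : ∀ y z → ∂ x (y · z · v) u ≈ same y x * (z · v) u + same z x * (y · v) u
    twice y z = trans (∂-· x y (z · v) u)
      (+-congˡ (trans (·-cong y (∂-·-closed cv x z) u) (·-⊙ y (same z x) v u)))

  [ab]·-ab : ∀ v u → ([ab]· v) (a ∷ b ∷ u) ≈ v u
  [ab]·-ab v u = solve 3 (λ m x y → con 1 :* (con 1 :* x) :+ m :* (con 0 :* y) := x) refl _ (v u) _

  [ab]·-ba : ∀ v u → ([ab]· v) (b ∷ a ∷ u) ≈ - v u
  [ab]·-ba v u = trans
    (solve 3 (λ m x y → con 0 :* y :+ m :* (con 1 :* (con 1 :* x)) := m :* x) refl _ (v u) _)
    (-1*x≈-x _)

  -- Right multiplication by a is written as the conjugate of left multiplication
  -- by reversal.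
  ad : Fun → Fun
  ad v = a · v ⊕ (- 1#) ⊙ ((a · (v ∘ reverse)) ∘ reverse)

  -- Multiplying a closed `v` by `a` on either side gives a function with derivative `same a x ⊙ v`.
  ad-closed : Closed v → Closed (ad v)
  ad-closed {v} cv x u = begin
    ∂ x (ad v) u
      ≈⟨ trans (∂.T-⊕ x (a · v) _ u) (+-congˡ (∂.T-⊙ x (- 1#) ((a · (v ∘ reverse)) ∘ reverse) u)) ⟩
    ∂ x (a · v) u + - 1# * ∂ x ((a · (v ∘ reverse)) ∘ reverse) u
      ≈⟨ +-cong (∂-·-closed cv x a u) (*-congˡ (begin
           ∂ x ((a · (v ∘ reverse)) ∘ reverse) u    ≈⟨ ∂-reverse x (a · (v ∘ reverse)) u ⟩
           ∂ x (a · (v ∘ reverse)) (reverse u)      ≈⟨ ∂-·-closed cv′ x a (reverse u) ⟩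
           same a x * v (reverse (reverse u))       ≈⟨ *-congˡ (cong≈ v (ListP.reverse-involutive u)) ⟩
           same a x * v u                           ∎)) ⟩
    same a x * v u + - 1# * (same a x * v u)
      ≈⟨ x-x≈0 _ ⟩
    0# ∎
    where
    cv′ : Closed (v ∘ reverse)
    cv′ y t = trans (∂-reverse y v t) (cv y (reverse t))

  -- Parity is recorded at one word and its reversal only, the two places at which `ψ` looks.
  record Witness (d : ℕ) (ε : Carrier) : Set (c ⊔ ℓ) where
    field
      fun      : Fun
      closed   : Closed fun
      word     : List Bool
      length-d : length word ≡ d
      at-word  : fun word ≈ 1#
      at-rev   : fun (reverse word) ≈ ε
  open Witness

  -- The commutator with `a` is evaluated at `a ∷ word`. As `word` ends in `b`, right multiplication
  -- by `a` contributes nothing there, and left multiplication nothing at the reversal.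
  EndsInB : Witness d ε → Set
  EndsInB W = ∃ λ t → reverse (word W) ≡ b ∷ t

  Witnessᵇ : ℕ → Carrier → Set _
  Witnessᵇ d ε = Σ (Witness d ε) EndsInB

  resp : ε ≈ ε′ → Witnessᵇ d ε → Witnessᵇ d ε′
  resp eq (W , end) = record
    { fun = fun W ; closed = closed W ; word = word W ; length-d = length-d W
    ; at-word = at-word W ; at-rev = trans (at-rev W) eq } , end

  witness-0 : Witness 0 1#
  witness-0 = record
    { fun = one ; closed = one-closed ; word = [] ; length-d = ≡.refl ; at-word = refl ; at-rev = refl }

  witness-2 : Witnessᵇ 2 (- 1#)
  witness-2 = record
    { fun = [ab]· one ; closed = [ab]·-closed one-closed
    ; word = a ∷ b ∷ [] ; length-d = ≡.refl
    ; at-word = [ab]·-ab one [] ; at-rev = [ab]·-ba one [] } , _ , ≡.refl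

  witness-4 : Witnessᵇ 4 1#
  witness-4 = record
    { fun = [ab]· ([ab]· one) ; closed = [ab]·-closed ([ab]·-closed one-closed)
    ; word = a ∷ b ∷ a ∷ b ∷ [] ; length-d = ≡.refl
    ; at-word = trans ([ab]·-ab ([ab]· one) (a ∷ b ∷ [])) ([ab]·-ab one [])
    ; at-rev  = trans ([ab]·-ba ([ab]· one) (b ∷ a ∷ [])) (trans (-‿cong ([ab]·-ba one [])) (-‿involutive 1#))
    } , _ , ≡.refl

  -- In [a, f] the term a f supplies the coefficient 1 at the new word, and the term - f a supplies
  -- - ε at its reversal.
  witness-ad : Witnessᵇ d ε → Witnessᵇ (suc d) (- ε)
  witness-ad {d} {ε} (W , t , rev) = record
    { fun = ad f ; closed = ad-closed (closed W)
    ; word = a ∷ u ; length-d = ≡.cong suc (length-d W)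
    ; at-word = begin
        1# * f u + - 1# * (a · (f ∘ reverse)) (reverse (a ∷ u))
          ≈⟨ +-cong (trans (*-identityˡ _) (at-word W))
                    (*-congˡ (trans (cong≈ (a · (f ∘ reverse)) rev′) (zeroˡ _))) ⟩
        1# + - 1# * 0#
          ≈⟨ trans (+-congˡ (zeroʳ _)) (+-identityʳ 1#) ⟩
        1# ∎
    ; at-rev = begin
        (a · f) (reverse (a ∷ u)) + - 1# * (a · (f ∘ reverse)) (reverse (reverse (a ∷ u)))
          ≈⟨ +-cong (trans (cong≈ (a · f) rev′) (zeroˡ _))
                    (*-congˡ (cong≈ (a · (f ∘ reverse)) (ListP.reverse-involutive (a ∷ u)))) ⟩
        0# + - 1# * (1# * f (reverse u))
          ≈⟨ trans (+-identityˡ _) (*-congˡ (trans (*-identityˡ _) (at-rev W))) ⟩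
        - 1# * ε
          ≈⟨ -1*x≈-x ε ⟩
        - ε ∎
    } , t ∷ʳ a , rev′
    where
    f = fun W
    u = word W
    rev′ : reverse (a ∷ u) ≡ b ∷ (t ∷ʳ a)
    rev′ = ≡.trans (ListP.unfold-reverse a u) (≡.cong (_∷ʳ a) rev)

  witness-3 : Witnessᵇ 3 1#
  witness-3 = resp (-‿involutive 1#) (witness-ad witness-2)

  -- In degree 4 the sign + comes from [a,b]² and the sign - from [a,[a,[a,b]]]. Each further
  -- commutator with `a` exchanges the signs.
  witness-4+ : ∀ j → Witnessᵇ (4 ℕ.+ j) 1# × Witnessᵇ (4 ℕ.+ j) (- 1#)
  witness-4+ zero    = witness-4 , witness-ad witness-3
  witness-4+ (suc j) with witness-4+ j
  ... | W⁺ , W⁻ = resp (-‿involutive 1#) (witness-ad W⁻) , witness-ad W⁺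

  pow : ℕ → Fun → Fun
  pow zero    v = v
  pow (suc m) v = a · pow m v

  ∂-pow : Closed v → ∀ x m → ∂ x (pow (suc m) v) ≋ (same a x * natK (suc m)) ⊙ pow m v
  ∂-pow cv x zero    u = trans (∂-·-closed cv x a u)
    (*-congʳ (solve 1 (λ s → s := s :* (con 1 :+ con 0)) refl _))
  ∂-pow {v} cv x (suc m) u = begin
    ∂ x (a · pow (suc m) v) u
      ≈⟨ ∂-· x a (pow (suc m) v) u ⟩
    same a x * pow (suc m) v u + (a · ∂ x (pow (suc m) v)) u
      ≈⟨ +-congˡ (trans (·-cong a (∂-pow cv x m) u) (·-⊙ a _ (pow m v) u)) ⟩
    same a x * pow (suc m) v u + (same a x * natK (suc m)) * pow (suc m) v u
      ≈⟨ solve 3 (λ s n p → s :* p :+ (s :* n) :* p := (s :* (con 1 :+ n)) :* p) refl _ _ _ ⟩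
    (same a x * natK (suc (suc m))) * pow (suc m) v u ∎

  -- The scalar by which `D xs` takes the power r + `length xs` of `a` down to the power r. The head
  -- of `xs` acts last, on the power r + 1. For m letters `a` and r = 0 it is m!.
  coefficient : List Bool → ℕ → Carrier
  coefficient []       r = 1#
  coefficient (x ∷ xs) r = (same a x * natK (suc r)) * coefficient xs (suc r)

  D-pow : Closed v → ∀ xs r → D xs (pow (length xs ℕ.+ r) v) ≋ coefficient xs r ⊙ pow r v
  D-pow cv []       r u = sym (*-identityˡ _)
  D-pow {v} cv (x ∷ xs) r u = begin
    ∂ x (D xs (pow (suc (length xs ℕ.+ r)) v)) u
      ≈⟨ ∂.T-cong x (λ t → trans (reflexive (≡.cong (λ m → D xs (pow m v) t) (≡.sym (ℕP.+-suc (length xs) r))))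
                                 (D-pow cv xs (suc r) t)) u ⟩
    ∂ x (coefficient xs (suc r) ⊙ pow (suc r) v) u
      ≈⟨ trans (∂.T-⊙ x _ (pow (suc r) v) u) (*-congˡ (∂-pow cv x r u)) ⟩
    coefficient xs (suc r) * ((same a x * natK (suc r)) * pow r v u)
      ≈⟨ solve 3 (λ k l p → k :* (l :* p) := (l :* k) :* p) refl _ _ _ ⟩
    ((same a x * natK (suc r)) * coefficient xs (suc r)) * pow r v u ∎

  D-pow-length : Closed v → ∀ {m} xs → length xs ≡ m → D xs (pow m v) ≋ coefficient xs 0 ⊙ v
  D-pow-length {v} cv xs ≡.refl u = trans
    (reflexive (≡.cong (λ m → D xs (pow m v) u) (≡.sym (ℕP.+-identityʳ (length xs)))))
    (D-pow cv xs 0 u)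

  pow-killed : Closed v → ∀ {n} m → Killed n (suc m) (pow m v)
  pow-killed {v} cv m (x ∷ xs) u p q = begin
    ∂ x (D xs (pow m v)) u          ≈⟨ ∂.T-cong x (D-pow-length cv xs (ℕP.suc-injective p)) u ⟩
    ∂ x (coefficient xs 0 ⊙ v) u    ≈⟨ ∂.T-⊙ x _ v u ⟩
    coefficient xs 0 * ∂ x v u      ≈⟨ *-congˡ (cv x u) ⟩
    coefficient xs 0 * 0#           ≈⟨ zeroʳ _ ⟩
    0#                              ∎

  coefficient≉0 : ∀ m r → ¬ (coefficient (replicate m a) r ≈ 0#)
  coefficient≉0 zero    r eq = 1≉0 eq
  coefficient≉0 (suc m) r eq = coefficient≉0 m (suc r)
    (noZeroDivisors (char0 r ∘ trans (sym (*-identityˡ _))) eq)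

  -- For f = aᵐQ with Q the witness, `ψ` of p(T) f is both 0 and p(ε m) times `ψ` of f, and the
  -- latter value of `ψ` is nonzero in characteristic 0.
  eigenvalue : ∀ {n m T} (T-flipped : IsFlippedShuffle T) → Witness d ε → ε * ε ≈ 1# → m ℕ.+ d ≡ n →
               ∀ p → (∀ v → Killed n 0 (FlippedShuffle.evalT F T-flipped p v)) →
               horner p (ε * natK m) ≈ 0#
  eigenvalue {ε = ε} {n} {m} T-flipped W ε²≈1 m+d≡n p p≈0 = noZeroDivisors ψv≉0 (begin
    ψ′ f * horner p (ε * natK m)    ≈⟨ *-comm _ _ ⟩
    horner p (ε * natK m) * ψ′ f    ≈⟨ ψ-evalT ε²≈1 {bs} {u} bs≡m m+u≡n p (pow-killed (closed W) m) ⟨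
    ψ′ (evalT p f)                  ≈⟨ +-cong (killed m (p≈0 f) bs u bs≡m m+u≡n)
                                        (*-congˡ (killed m (p≈0 f) bs (reverse u) bs≡m (+-length-reverse u m+u≡n))) ⟩
    0# + ε * 0#                     ≈⟨ trans (+-identityˡ _) (zeroʳ ε) ⟩
    0#                              ∎)
    where
    open FlippedShuffle F T-flipped
    f = pow m (fun W)
    bs = replicate m a
    u = word W
    bs≡m : length bs ≡ m
    bs≡m = ListP.length-replicate m
    m+u≡n : m ℕ.+ length u ≡ n
    m+u≡n = ≡.trans (≡.cong (m ℕ.+_) (length-d W)) m+d≡n
    ψ′ : Fun → Carrier
    ψ′ = ψ ε²≈1 {bs} {u} bs≡m m+u≡n

    killed : ∀ m {w} → Killed n 0 w → Killed n m w
    killed zero    kw = kw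
    killed (suc m) kw = killed-suc (killed m kw)

    -- The word contributes 1 and its reversal contributes ε² = 1, whence the factor 2.
    ψv≈ : ψ′ f ≈ coefficient bs 0 * natK 2
    ψv≈ = begin
      D bs f u + ε * D bs f (reverse u)
        ≈⟨ +-cong (trans (D-pow-length (closed W) bs bs≡m u) (*-congˡ (at-word W)))
                  (*-congˡ (trans (D-pow-length (closed W) bs bs≡m (reverse u)) (*-congˡ (at-rev W)))) ⟩
      k * 1# + ε * (k * ε)
        ≈⟨ solve 2 (λ k ε → k :* con 1 :+ ε :* (k :* ε) := k :* (con 1 :+ (ε :* ε :+ con 0))) refl k ε ⟩
      k * (1# + (ε * ε + 0#))
        ≈⟨ *-congˡ (+-congˡ (+-congʳ ε²≈1)) ⟩
      k * natK 2 ∎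
      where k = coefficient bs 0

    ψv≉0 : ¬ (ψ′ f ≈ 0#)
    ψv≉0 eq = char0 1 (noZeroDivisors (coefficient≉0 m 0) (trans (sym ψv≈) eq))

  1*1≈1 : 1# * 1# ≈ 1#
  1*1≈1 = *-identityˡ 1#

  -1*-1≈1 : - 1# * - 1# ≈ 1#
  -1*-1≈1 = trans (-1*x≈-x (- 1#)) (-‿involutive 1#)

  horner-cong : ∀ p {x y} → x ≈ y → horner p x ≈ horner p y
  horner-cong []      eq = refl
  horner-cong (k ∷ p) eq = +-congˡ (*-cong eq (horner-cong p eq))

  intK-neg : ∀ m → intK (ℤ.- + m) ≈ - 1# * natK m
  intK-neg zero    = sym (zeroʳ _)
  intK-neg (suc m) = sym (-1*x≈-x _)

  -- Each k in L(n) is written as ε m such that a witness of sign ε exists in degree n - m: + in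
  -- degrees 0 and 3, - in degree 2, both from degree 4 on.
  eigenvalues : ∀ {n T} (T-flipped : IsFlippedShuffle T) → 1 ℕ.< n →
                ∀ p → (∀ v → Killed n 0 (FlippedShuffle.evalT F T-flipped p v)) →
                ∀ k → InL n k → horner p (intK k) ≈ 0#
  eigenvalues {n} T-flipped 1<n p p≈0 = go
    where
    plus : ∀ m d → Witness d 1# → m ℕ.+ d ≡ n → horner p (natK m) ≈ 0#
    plus m d W eq = trans (horner-cong p (sym (*-identityˡ _)))
                          (eigenvalue T-flipped W 1*1≈1 eq p p≈0)

    minus : ∀ m d → Witness d (- 1#) → m ℕ.+ d ≡ n → horner p (intK (ℤ.- + m)) ≈ 0#
    minus m d W eq = trans (horner-cong p (intK-neg m)) (eigenvalue T-flipped W -1*-1≈1 eq p p≈0)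

    complement : ∀ {i m} → i ℕ.+ m ℕ.≤ n → ∃ λ j → m ℕ.+ (i ℕ.+ j) ≡ n
    complement {i} {m} le with j , ≡.refl ← ℕP.m≤n⇒∃[o]m+o≡n le =
      j , ≡.trans (≡.sym (ℕP.+-assoc m i j)) (≡.cong (ℕ._+ j) (ℕP.+-comm m i))

    -- For m = 0 both signs give the eigenvalue 0, so any witness of degree n will do; there is one
    -- because n is at least 2.
    zero∈ : ∀ j → 2 ℕ.+ j ≡ n → horner p (natK 0) ≈ 0#
    zero∈ 0             eq = minus 0 2 (proj₁ witness-2) eq
    zero∈ 1             eq = plus 0 3 (proj₁ witness-3) eq
    zero∈ (suc (suc j)) eq = plus 0 (4 ℕ.+ j) (proj₁ (proj₁ (witness-4+ j))) eq

    plus∈ : ∀ m j → m ℕ.+ (3 ℕ.+ j) ≡ n → horner p (natK m) ≈ 0#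
    plus∈ m zero    eq = plus m 3 (proj₁ witness-3) eq
    plus∈ m (suc j) eq = plus m (4 ℕ.+ j) (proj₁ (proj₁ (witness-4+ j))) eq

    go : ∀ k → InL n k → horner p (intK k) ≈ 0#
    go k (inj₁ k≡) with complement {2} {0} 1<n
    ... | j , ≡.refl = ≡.subst (λ i → horner p (intK i) ≈ 0#) (≡.sym k≡-j)
                         (minus j 2 (proj₁ witness-2) (ℕP.+-comm j 2))
      where
      k≡-j : k ≡ ℤ.- + j
      k≡-j = ≡.trans k≡ (neg-2+ j)
    go (+ m) (inj₂ (inj₁ (_ , le))) with complement {3} {m}
      (≡.subst (ℕ._≤ n) (ℕP.+-comm m 3) (ℤP.drop‿+≤+ (≤-minus⁻ (+ 3) le)))
    ... | j , eq = plus∈ m j eq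
    go -[1+ m ] (inj₂ (inj₁ (le , _))) with complement {4} {suc m}
      (ℤP.drop‿+≤+ (≤-minus⁻ {+ 4} {+ n} (+ suc m) (neg≤⁻ (+ n) le)))
    ... | j , eq = minus (suc m) (4 ℕ.+ j) (proj₁ (proj₂ (witness-4+ j))) eq
    go k (inj₂ (inj₂ (inj₁ ≡.refl))) with complement {2} {0} 1<n
    ... | j , eq = zero∈ j eq
    go k (inj₂ (inj₂ (inj₂ ≡.refl))) = plus n 0 witness-0 (ℕP.+-identityʳ n)

-- The list of elements of L(n).

pos∈intRange : ∀ {m n} → m ℕ.≤ n → + m ∈ intRange n
pos∈intRange {m} {n} m≤n = ≡.subst (_∈ intRange n) eq
  (∈-map⁺ (λ i → ℤ.- + n ℤ.+ + i) (∈-upTo⁺ (ℕ.s≤s (ℕP.+-monoʳ-≤ n (ℕP.≤-trans m≤n (ℕP.m≤m+n n 0))))))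
  where
  eq : ℤ.- + n ℤ.+ + (n ℕ.+ m) ≡ + m
  eq = ≡.trans (≡.sym (ℤP.+-assoc (ℤ.- + n) (+ n) (+ m)))
         (≡.trans (≡.cong (ℤ._+ + m) (ℤP.+-inverseˡ (+ n))) (ℤP.+-identityˡ (+ m)))

neg∈intRange : ∀ {m n} → m ℕ.≤ n → ℤ.- + m ∈ intRange n
neg∈intRange {m} m≤n with j , ≡.refl ← ℕP.m≤n⇒∃[o]m+o≡n m≤n = ≡.subst (_∈ intRange (m ℕ.+ j)) eq
  (∈-map⁺ (λ i → ℤ.- + (m ℕ.+ j) ℤ.+ + i)
    (∈-upTo⁺ (ℕ.s≤s (ℕP.≤-trans (ℕP.m≤n+m j m) (ℕP.m≤m+n (m ℕ.+ j) _)))))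
  where
  eq : ℤ.- + (m ℕ.+ j) ℤ.+ + j ≡ ℤ.- + m
  eq = ≡.trans (≡.cong (ℤ._+ + j) (ℤP.neg-distrib-+ (+ m) (+ j))) (i-j+j≡i (ℤ.- + m) (+ j))

∈-intRange : ∀ {n} k → ℤ.∣ k ∣ ℕ.≤ n → k ∈ intRange n
∈-intRange (+ m)    = pos∈intRange
∈-intRange -[1+ m ] = neg∈intRange

Lset-unique : ∀ n → Unique (Lset n)
Lset-unique n = UniqueP.filter⁺ (inL? n)
  (UniqueP.map⁺ (λ eq → ℤP.+-injective (∙-cancelˡ (ℤ.- + n) _ _ eq)) (UniqueP.upTo⁺ (suc (2 ℕ.* n))))
  where open import Algebra.Properties.Group (AbelianGroup.group ℤP.+-0-abelianGroup) using (∙-cancelˡ)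

toVec : ∀ {X : Set} {n} (t : List X) → length t ≡ n → ∃ λ (u : Vec X n) → toList u ≡ t
toVec t ≡.refl = Vec.fromList t , VecP.toList∘fromList t

-- Transfer between the group algebra and words, and the minimal polynomial.

module MinimalPolynomial {c ℓ} (F : Field c ℓ) (char0 : FieldOps.CharZero F) (n : ℕ) (1<n : 1 ℕ.< n)
  (s : GroupAlgebra.KS F n)
  (T : ∀ {X : Set} → Words.Fun F X → Words.Fun F X)
  (T-flipped : ∀ {X : Set} → Words.IsFlippedShuffle F X T)
  (place-s : ∀ {X : Set} (v : Words.Fun F X) (u : Vec X n) →
             Field._≈_ F (PlaceAction.place F n s (λ t → v (toList t)) u) (T v (toList u)))
  where
  open Field F
  open GroupAlgebra F n
  open Polynomials F
  open import Relation.Binary.Reasoning.Setoid setoid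

  module _ {X : Set} where
    open PlaceAction F n {X}
    open Words F X
    open FlippedShuffle F {X = X} T-flipped

    place-evalP : ∀ p v u → place (evalP p s) (v ∘ toList) u ≈ evalT p v (toList u)
    place-evalP []      v u = trans (∑-cong (perms n) (λ _ → zeroˡ _)) (∑-0 (perms n))
      where open Sums F
    place-evalP (k ∷ p) v u = begin
      place (scalar k +ₐ (s *ₐ evalP p s)) V u
        ≈⟨ place-+ (scalar k) (s *ₐ evalP p s) V u ⟩
      place (scalar k) V u + place (s *ₐ evalP p s) V u
        ≈⟨ +-cong (place-scalar k V u) (place-* s (evalP p s) V u) ⟩
      k * V u + place s (place (evalP p s) V) u
        ≈⟨ +-congˡ (place-cong s (place-evalP p v) u) ⟩
      k * V u + place s (evalT p v ∘ toList) u
        ≈⟨ +-congˡ (place-s (evalT p v) u) ⟩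
      k * V u + T (evalT p v) (toList u) ∎
      where V = v ∘ toList

    evalP≈0⇒evalT≈0 : ∀ p → evalP p s ≈ₐ 0ₐ → ∀ v → Killed n 0 (evalT p v)
    evalP≈0⇒evalT≈0 p p≈0 v [] t _ eq with toVec t eq
    ... | u , ≡.refl = begin
      evalT p v (toList u)                ≈⟨ place-evalP p v u ⟨
      place (evalP p s) (v ∘ toList) u    ≈⟨ ∑-cong (perms n) (λ {σ} σ∈ → trans (*-congʳ (p≈0 σ σ∈)) (zeroˡ _)) ⟩
      ∑ (perms n) (λ _ → 0#)              ≈⟨ ∑-0 (perms n) ⟩
      0#                                  ∎
      where open Sums F

  open PlaceAction F n {Fin n}
  open Words F (Fin n)
  open FlippedShuffle F {X = Fin n} T-flipped

  indicator : Perm → Fun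
  indicator σ t = if does (ListP.≡-dec FinP._≟_ t (toList σ)) then 1# else 0#

  indicator-δ : ∀ σ τ → indicator σ (toList τ) ≈ δ σ τ
  indicator-δ σ τ with ListP.≡-dec FinP._≟_ (toList τ) (toList σ) | σ ≟ₚ τ
  ... | yes _  | yes _      = refl
  ... | no _   | no _       = refl
  ... | yes eq | no σ≢τ     = contradiction
    (≡.trans (≡.sym (VecP.toList-injective ≡.refl τ σ eq)) (VecP.cast-is-id ≡.refl τ)) σ≢τ
  ... | no neq | yes ≡.refl = contradiction ≡.refl neq

  -- Faithfulness: each τ takes the word `tabulate id` to τ itself, so acting on the indicator of σ
  -- and evaluating at this word returns the coefficient at σ.
  evalT≈0⇒evalP≈0 : ∀ p → (∀ v → Killed n 0 (evalT p v)) → evalP p s ≈ₐ 0ₐ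
  evalT≈0⇒evalP≈0 p p≈0 σ σ∈ = begin
    evalP p s σ
      ≈⟨ ∑-δ σ∈ (evalP p s) ⟨
    ∑ (perms n) (λ τ → δ σ τ * evalP p s τ)
      ≈⟨ ∑-cong (perms n) (λ {τ} _ → trans (*-comm _ _) (*-congˡ (trans (sym (indicator-δ σ τ))
           (reflexive (≡.cong (indicator σ ∘ toList) (≡.sym (id-act τ))))))) ⟩
    place (evalP p s) (indicator σ ∘ toList) (tabulate id)
      ≈⟨ place-evalP p (indicator σ) (tabulate id) ⟩
    evalT p (indicator σ) (toList (tabulate id))
      ≈⟨ killed-zero (p≈0 (indicator σ)) (toList (tabulate id)) (VecP.length-toList (tabulate {n = n} id)) ⟩
    0# ∎
    where open Sums F

  isMinimal : IsMinimalPolynomial s (minPolyL F n)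
  isMinimal = length ks , toMonicOfDegree (monic-prodP ks) , annihilates , minimal
    where
    ks = map intK (Lset n)

    annihilates : evalP (prodP ks) s ≈ₐ 0ₐ
    annihilates = evalT≈0⇒evalP≈0 (prodP ks) λ v → killed-cong (λ u → sym (evalT-prodP (Lset n) v u))
      (annihilate n 0 (ℕP.+-identityʳ n) (Lset n)
        (λ k k∈L ∣k∣≤n → ∈-filter⁺ (inL? n) (∈-intRange k ∣k∣≤n) k∈L) killed-all)

    minimal : ∀ e q → MonicOfDegree e q → evalP q s ≈ₐ 0ₐ → length ks ℕ.≤ e
    -- The alphabet is `Bool` here, while annihilation was tested on words over `Fin n`. The
    -- elements of L(n) are distinct roots of `q`, as characteristic 0 keeps distinct integers
    -- distinct.
    minimal e q mon q≈0 = roots≤degree (fromMonicOfDegree mon) ks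
      (AllP.map⁺ (All.tabulate λ {k} k∈ → Eigenvectors.eigenvalues F char0 T-flipped 1<n q
        (evalP≈0⇒evalT≈0 q q≈0) k (proj₂ (∈-filter⁻ (inL? n) {xs = intRange n} k∈))))
      (AllPairsP.map⁺ (AllPairs.map (λ i≢j eq → i≢j (intK-injective char0 _ _ eq)) (Lset-unique n)))

theorem9p5 : ∀ {c ℓ} (F : Field c ℓ) → FieldOps.CharZero F → (n : ℕ) → 1 < n →
    GroupAlgebra.IsMinimalPolynomial F n (GroupAlgebra._*ₐ_ F n (GroupAlgebra.W₀ F n) (GroupAlgebra.A F n)) (minPolyL F n)
    × GroupAlgebra.IsMinimalPolynomial F n (GroupAlgebra._*ₐ_ F n (GroupAlgebra.A F n) (GroupAlgebra.W₀ F n)) (minPolyL F n)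
theorem9p5 F char0 n 1<n =
    MinimalPolynomial.isMinimal F char0 n 1<n (W₀ *ₐ A) (Words.reverse∘toFront F _)
      (Words.reverse∘toFront-flipped F _)
      (λ v u → trans (place-* W₀ A (v ∘ toList) u)
                 (trans (place-cong W₀ (place-A F n v) u) (place-W₀ (Words.toFront F _ v) u)))
  , MinimalPolynomial.isMinimal F char0 n 1<n (A *ₐ W₀) (Words.toFront∘reverse F _)
      (Words.toFront∘reverse-flipped F _)
      (λ v u → trans (place-* A W₀ (v ∘ toList) u)
                 (trans (place-cong A (place-W₀ v) u) (place-A F n (v ∘ reverse) u)))
  where
  open Field F using (trans)
  open GroupAlgebra F n
  open PlaceAction F n
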